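{- For each $\gamma \in (0,\frac{1}{2}]$ and each $0<\delta<1$, there is a sequence $(x_n)_{n\in\mathbb{N}}$ that has weak $\gamma$-PPC (with parameter $\delta$) but does not have $\gamma$-PPC.
   Context: $\|\cdot\|$ denotes the distance to the nearest integer, and $\sharp$ denotes cardinality; pairs $(m,n)$ below are ordered pairs. For $\gamma\in(0,1)$, a sequence $(x_n)_{n\in\mathbb{N}}\subseteq[0,1)$ has $\gamma$-PPC (inhomogeneous Poissonian pair correlation) if for every $s>0$, $$\lim_{N \to \infty}\frac{1}{N}\,\sharp \left\{ 1 \leq m \neq n \leq N : \|x_m - x_n-\gamma\| \leq \frac{s}{N} \right\} = 2s.$$ For $\gamma\in(0,1)$ and $0<\delta<1$, a sequence $(x_n)_{n\in\mathbb{N}}$ has weak $\gamma$-PPC (with parameter $\delta$) if for every $s>0$, $$\lim_{N\to\infty}\frac{1}{N^{2-\delta}}\,\sharp \left\{ 1 \leq m \neq n \leq N : \|x_m - x_n-\gamma\| \leq \frac{s}{N^{\delta}} \right\} =2s.$$ Sequences are considered modulo one. -}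

module Defs where

open import Algebra.Bundles using (CommutativeRing; Semiring)
open import Algebra.Core using (Op₁; Op₂)
open import Algebra.Structures using (IsCommutativeRing)
import Algebra.Definitions.RawSemiring as RawSemiringOps
open import Data.Bool.Base using (if_then_else_)
open import Data.Integer.Base using (ℤ; +_; -[1+_])
open import Data.List.Base using (List; length; filter; map; upTo; cartesianProduct)
open import Data.Nat.Base as ℕ using (ℕ; suc)
import Data.Nat.Properties as ℕ
open import Data.Product.Base using (_×_; _,_; ∃; ∃-syntax)
open import Level using (0ℓ)
open import Relation.Binary.Core using (Rel)
import Relation.Binary.Construct.NonStrictToStrict as NonStrictToStrict
open import Relation.Binary.Structures using (IsDecTotalOrder)
open import Relation.Nullary.Decidable using (does; ¬?; _×-dec_)
open import Relation.Nullary.Negation.Core using (¬_)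
open import Relation.Unary using (Pred)

-- The real numbers of classical mathematics, described as a complete
-- ordered field; classically such a field is unique up to isomorphism.
-- The order is decidable because the reals here are the classical ones.

record CompleteOrderedField : Set₁ where
  infix  9 _⁻¹
  infix  9 -_
  infixl 7 _*_
  infixl 6 _+_
  infix  4 _≈_ _≤_

  field
    Carrier : Set
    _≈_ _≤_ : Rel Carrier 0ℓ
    _+_ _*_ : Op₂ Carrier
    -_ _⁻¹  : Op₁ Carrier
    0# 1#   : Carrier

    isCommutativeRing : IsCommutativeRing _≈_ _+_ _*_ -_ 0# 1#
    0≉1               : ¬ (0# ≈ 1#)
    -- 0# ⁻¹ is left unspecified.
    ⁻¹-inverseʳ       : ∀ x → ¬ (x ≈ 0#) → x * x ⁻¹ ≈ 1#

    isDecTotalOrder   : IsDecTotalOrder _≈_ _≤_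
    +-monoʳ-≤         : ∀ x {y z} → y ≤ z → x + y ≤ x + z
    *-nonNegative     : ∀ {x y} → 0# ≤ x → 0# ≤ y → 0# ≤ x * y

  open NonStrictToStrict _≈_ _≤_ public using (_<_)

  -- Leastness of b is given by witnesses: no y < b is an upper bound
  -- because some element of P exceeds y.
  IsSupremum : Pred Carrier 0ℓ → Carrier → Set
  IsSupremum P b = (∀ x → P x → x ≤ b) × (∀ y → y < b → ∃[ x ] P x × y < x)

  field
    -- The value is unspecified if P is empty or unbounded above.
    sup          : Pred Carrier 0ℓ → Carrier
    sup-supremum : ∀ P → ∃ P → (∃[ b ] ∀ x → P x → x ≤ b) → IsSupremum P (sup P)

  commutativeRing : CommutativeRing 0ℓ 0ℓ
  commutativeRing = record { isCommutativeRing = isCommutativeRing }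

  open IsDecTotalOrder isDecTotalOrder public using (_≤?_)

module RealNotions (R : CompleteOrderedField) where
  open CompleteOrderedField R public
  open RawSemiringOps (Semiring.rawSemiring (CommutativeRing.semiring commutativeRing)) public
    using (_^_) renaming (_×_ to _·_)

  infixl 6 _-_
  infixl 7 _/_

  _-_ _/_ : Op₂ Carrier
  x - y = x + - y
  x / y = x * y ⁻¹

  fromℕ : ℕ → Carrier
  fromℕ n = n · 1#

  fromℤ : ℤ → Carrier
  fromℤ (+ n)    = fromℕ n
  fromℤ -[1+ n ] = - fromℕ (suc n)

  ∣_∣ : Op₁ Carrier
  ∣ x ∣ = if does (0# ≤? x) then x else - x

  inf : Pred Carrier 0ℓ → Carrier
  inf P = - sup (λ y → P (- y))

  ‖_‖ : Op₁ Carrier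
  ‖ x ‖ = inf (λ d → ∃[ k ] d ≈ ∣ x - fromℤ k ∣)

  -- The nonnegative q-th root of z, for q ≥ 1 and z ≥ 0.
  root : ℕ → Carrier → Carrier
  root q z = sup (λ t → 0# ≤ t × t ^ q ≤ z)

  -- The real power b ^ a, for b ≥ 1 and a ≥ 0: the supremum of the powers
  -- b ^ (p / q) = (b ^ p) ^ (1 / q) over the rationals 0 ≤ p / q ≤ a, where
  -- the denominator q is written suc q.
  rpow : Carrier → Carrier → Carrier
  rpow b a = sup (λ y → ∃[ p ] ∃[ q ]
    (fromℕ p ≤ a * fromℕ (suc q)) × (y ≈ root (suc q) (b ^ p)))

  _⟶_ : (ℕ → Carrier) → Carrier → Set
  f ⟶ l = ∀ ε → 0# < ε → ∃[ N₀ ] ∀ N → N₀ ℕ.≤ N → ∣ f N - l ∣ < ε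

  -- ♯ { (m , n) : 1 ≤ m ≠ n ≤ N , ‖ x m - x n - γ ‖ ≤ r }
  pairCount : (ℕ → Carrier) → Carrier → Carrier → ℕ → ℕ
  pairCount x γ r N = length (filter close? (cartesianProduct indices indices))
    where
    indices : List ℕ
    indices = map suc (upTo N)

    close? = λ ((m , n) : ℕ × ℕ) →
      ¬? (m ℕ.≟ n) ×-dec (‖ x m - x n - γ ‖ ≤? r)

  -- Sequences are indexed by 1, 2, 3, …; the term x 0 plays no role.
  InUnitInterval : (ℕ → Carrier) → Set
  InUnitInterval x = ∀ n → 0# ≤ x n × x n < 1#

  HasPPC : Carrier → (ℕ → Carrier) → Set
  HasPPC γ x = ∀ s → 0# < s →
    (λ N → 1# / fromℕ N * fromℕ (pairCount x γ (s / fromℕ N) N))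
      ⟶ (fromℕ 2 * s)

  HasWeakPPC : Carrier → Carrier → (ℕ → Carrier) → Set
  HasWeakPPC γ δ x = ∀ s → 0# < s →
    (λ N → 1# / rpow (fromℕ N) (fromℕ 2 - δ)
             * fromℕ (pairCount x γ (s / rpow (fromℕ N) δ) N))
      ⟶ (fromℕ 2 * s)

{-# OPTIONS --safe #-}

-- The witness is the van der Corput sequence in base 2, for every γ and δ.  For
-- 0 ≤ r < 1/2 the condition ‖ y ‖ ≤ r has as indicator the number of integers in
-- [y - r , y + r], that is ⌊ y + r ⌋ + ⌊ r - y ⌋ + 1, and Hermite's identity
-- ⌊ y ⌋ + ⌊ y + 1/2 ⌋ = ⌊ 2 y ⌋ turns the digit recursion of the sequence into
-- an exact formula: the number of the first 2 M terms within r of a point c is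
-- the number of the first M terms within 2 r of 2 c.  By iteration, for N < 2 ^ k
-- this number differs from 2 r N by at most k, so the weak pair count with
-- r = s / N ^ δ is 2 s N ^ (2 - δ) + O (N log N).  For N = 2 ^ k the differences
-- of the first N terms are multiples of 1 / N, each equally often, so that the
-- pair count with r = 1 / (4 N) is an integer multiple of N, while γ-PPC would
-- make it about N / 2.
module Submission where

open import Defs
open import Algebra.Bundles using (CommutativeRing)
open import Algebra.Solver.Ring.AlmostCommutativeRing using (fromCommutativeRing; _-Raw-AlmostCommutative⟶_)
open import Data.Bool.Base using (if_then_else_; true; false)
open import Data.Integer.Base as ℤ using (ℤ; +_; -[1+_])
import Data.Integer.Properties as ℤ
open import Data.List.Base using (List; []; _∷_; _++_; length; filter; map; upTo; cartesianProduct)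
open import Data.List.Properties using (upTo-∷ʳ)
open import Data.Maybe.Base using (Maybe; just; nothing)
open import Data.Nat.Base as ℕ using (ℕ; zero; suc; pred; ⌊_/2⌋)
import Data.Nat.DivMod as ℕ
import Data.Nat.Properties as ℕ
open import Data.Product.Base using (_×_; _,_; proj₁; proj₂; ∃; ∃-syntax)
open import Data.Sum.Base using (_⊎_; inj₁; inj₂)
open import Function.Base using (_∘_)
open import Level using (0ℓ)
open import Relation.Binary.Bundles using (DecTotalOrder)
import Relation.Binary.PropositionalEquality as ≡
open ≡ using (_≡_; _≢_)
open import Relation.Nullary.Decidable using (Dec; yes; no; does; ¬?; _×-dec_)
open import Relation.Nullary.Negation using (contradiction)
open import Relation.Nullary.Negation.Core using (¬_)
open import Relation.Unary using (Pred; Decidable)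

-- The counting estimate is uniform in the centre `c`. The pairs with a fixed first term form a
-- count whose centre depends on that term, so a uniform bound can simply be summed over all first
-- terms. Counting integers with multiplicity, instead of using the indicator, is what lets the
-- doubling be iterated: the radius soon exceeds 1/2, where the floor formula still obeys the
-- doubling rule and the indicator does not. A small radius is required only where pairs are
-- translated into counts. Both bounds on δ enter: δ > 0 brings s / N ^ δ below 1/2, and δ < 1
-- leaves N ^ (2 - δ) room above N log N. Real powers are bare suprema, so the proof asks little of
-- them: positivity, the law N ^ (2 - δ) N ^ δ = N ^ 2, which turns the main term into exactly 2 s N
-- ^ (2 - δ), and lower bounds from the rational exponents 1 / (q + 1) and 1 + 1 / (q + 1), with q
-- large in terms of δ.

-- Natural numbers: halving, and powers of 2 against polynomials

halve : ∀ n → ∃[ m ] (n ≡ m ℕ.+ m ⊎ n ≡ suc (m ℕ.+ m))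
halve zero = 0 , inj₁ ≡.refl
halve (suc n) with halve n
... | m , inj₁ n≡m+m   = m , inj₂ (≡.cong suc n≡m+m)
... | m , inj₂ n≡1+m+m = suc m , inj₁ (≡.cong suc (≡.trans n≡1+m+m (≡.sym (ℕ.+-suc m m))))

half-<-2^ : ∀ k {m} → m ℕ.+ m ℕ.< 2 ℕ.^ suc k → m ℕ.< 2 ℕ.^ k
half-<-2^ k {m} h = ℕ.≰⇒> λ p → ℕ.<⇒≱ h
  (ℕ.+-mono-≤ p (ℕ.≤-trans (ℕ.≤-reflexive (ℕ.+-identityʳ (2 ℕ.^ k))) p))

n<2^n : ∀ n → n ℕ.< 2 ℕ.^ n
n<2^n zero    = ℕ.s≤s ℕ.z≤n
n<2^n (suc n) = ℕ.≤-trans (ℕ.+-mono-≤ (ℕ.≤-trans (ℕ.s≤s ℕ.z≤n) (n<2^n n)) (n<2^n n))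
  (ℕ.≤-reflexive (≡.cong (2 ℕ.^ n ℕ.+_) (≡.sym (ℕ.+-identityʳ (2 ℕ.^ n)))))

ℕ-^-distribʳ-* : ∀ m n o → (m ℕ.* n) ℕ.^ o ≡ m ℕ.^ o ℕ.* n ℕ.^ o
ℕ-^-distribʳ-* m n zero    = ≡.refl
ℕ-^-distribʳ-* m n (suc o) = ≡.trans (≡.cong (m ℕ.* n ℕ.*_) (ℕ-^-distribʳ-* m n o))
  (ℕ.[m*n]*[o*p]≡[m*o]*[n*p] m n (m ℕ.^ o) (n ℕ.^ o))

-- With d = suc q, j < d (j / d + 1) ≤ d 2 ^ (j / d), so j ^ d ≤ d ^ d 2 ^ j; one
-- of the d factors j then outweighs the constants.
2^-dominates : ∀ c q j → suc c ℕ.* suc q ℕ.^ suc q ℕ.≤ j → suc c ℕ.* j ℕ.^ q ℕ.≤ 2 ℕ.^ j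
2^-dominates c q j D≤j = ℕ.*-cancelʳ-≤ (C ℕ.* j ℕ.^ q) (2 ℕ.^ j) D {{ℕ.m*n≢0 C (d ℕ.^ d) {{_}} {{ℕ.m^n≢0 d d}}}} (begin
  C ℕ.* j ℕ.^ q ℕ.* D               ≤⟨ ℕ.*-monoʳ-≤ (C ℕ.* j ℕ.^ q) D≤j ⟩
  C ℕ.* j ℕ.^ q ℕ.* j               ≡⟨ ℕ.*-assoc C (j ℕ.^ q) j ⟩
  C ℕ.* (j ℕ.^ q ℕ.* j)             ≡⟨ ≡.cong (C ℕ.*_) (ℕ.*-comm (j ℕ.^ q) j) ⟩
  C ℕ.* j ℕ.^ d                     ≤⟨ ℕ.*-monoʳ-≤ C (ℕ.^-monoˡ-≤ d j≤) ⟩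
  C ℕ.* (2 ℕ.^ e ℕ.* d) ℕ.^ d       ≡⟨ ≡.cong (C ℕ.*_) (ℕ-^-distribʳ-* (2 ℕ.^ e) d d) ⟩
  C ℕ.* ((2 ℕ.^ e) ℕ.^ d ℕ.* d ℕ.^ d) ≡⟨ ≡.cong (λ x → C ℕ.* (x ℕ.* d ℕ.^ d)) (ℕ.^-*-assoc 2 e d) ⟩
  C ℕ.* (2 ℕ.^ (e ℕ.* d) ℕ.* d ℕ.^ d) ≤⟨ ℕ.*-monoʳ-≤ C (ℕ.*-monoˡ-≤ (d ℕ.^ d) (ℕ.^-monoʳ-≤ 2 (ℕ.m/n*n≤m j d))) ⟩
  C ℕ.* (2 ℕ.^ j ℕ.* d ℕ.^ d)       ≡⟨ ℕ.*-assoc C (2 ℕ.^ j) (d ℕ.^ d) ⟨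
  C ℕ.* 2 ℕ.^ j ℕ.* d ℕ.^ d         ≡⟨ ≡.cong (ℕ._* d ℕ.^ d) (ℕ.*-comm C (2 ℕ.^ j)) ⟩
  2 ℕ.^ j ℕ.* C ℕ.* d ℕ.^ d         ≡⟨ ℕ.*-assoc (2 ℕ.^ j) C (d ℕ.^ d) ⟩
  2 ℕ.^ j ℕ.* D                     ∎)
  where
  open ℕ.≤-Reasoning
  C = suc c
  d = suc q
  D = C ℕ.* d ℕ.^ d
  e = j ℕ./ d
  j≤ : j ℕ.≤ 2 ℕ.^ e ℕ.* d
  j≤ = ℕ.≤-trans (ℕ.≤-reflexive (ℕ.m≡m%n+[m/n]*n j d))
    (ℕ.≤-trans (ℕ.+-monoˡ-≤ (e ℕ.* d) (ℕ.<⇒≤ (ℕ.m%n<n j d))) (ℕ.*-monoˡ-≤ d (n<2^n e)))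

-- The lower bound lets `k` digits describe every index up to `suc n`; the upper bound keeps `2 ^ k`
-- comparable with `suc n`, so that `k` is only logarithmic. In the induction `k` grows only when
-- the number reaches `2 ^ k`.
binaryLength : ∀ n → ∃[ k ] suc n ℕ.< 2 ℕ.^ k × 2 ℕ.^ k ℕ.≤ 2 ℕ.* suc n
binaryLength zero    = 1 , ℕ.≤-refl , ℕ.≤-refl
binaryLength (suc n) with binaryLength n
... | k , n<2^k , 2^k≤2n with suc (suc n) ℕ.<? 2 ℕ.^ k
...   | yes h = k , h , ℕ.≤-trans 2^k≤2n (ℕ.*-monoʳ-≤ 2 (ℕ.n≤1+n (suc n)))
...   | no  h = suc k
  , ℕ.≤-<-trans n<2^k (ℕ.^-monoʳ-< 2 (ℕ.s≤s (ℕ.s≤s ℕ.z≤n)) (ℕ.n<1+n k))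
  , ℕ.*-monoʳ-≤ 2 (ℕ.≮⇒≥ h)

2^-cancel-< : ∀ {j k} → 2 ℕ.^ j ℕ.< 2 ℕ.^ k → j ℕ.< k
2^-cancel-< h = ℕ.≰⇒> λ k≤j → ℕ.<⇒≱ h (ℕ.^-monoʳ-≤ 2 k≤j)

-- This is the statement that powers of log n lose against n. The 4 absorbs the loss in
-- `2 ^ suc k ≤ 4 n`, and `suc (pred _)` gives the constant the positive form that `2^-dominates`
-- takes.
[l[1+k]]^q≤n : ∀ l q {k n} → suc (ℕ.pred (4 ℕ.* suc l ℕ.^ q)) ℕ.* suc q ℕ.^ suc q ℕ.≤ suc k →
  2 ℕ.^ k ℕ.≤ 2 ℕ.* n → (suc l ℕ.* suc k) ℕ.^ q ℕ.≤ n
[l[1+k]]^q≤n l q {k} {n} j₀≤ 2^k≤2n = ℕ.*-cancelˡ-≤ 4 (begin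
  4 ℕ.* (suc l ℕ.* suc k) ℕ.^ q           ≡⟨ ≡.cong (4 ℕ.*_) (ℕ-^-distribʳ-* (suc l) (suc k) q) ⟩
  4 ℕ.* (suc l ℕ.^ q ℕ.* suc k ℕ.^ q)     ≡⟨ ℕ.*-assoc 4 (suc l ℕ.^ q) (suc k ℕ.^ q) ⟨
  4 ℕ.* suc l ℕ.^ q ℕ.* suc k ℕ.^ q       ≡⟨ ≡.cong (ℕ._* suc k ℕ.^ q) 
    (ℕ.suc-pred (4 ℕ.* suc l ℕ.^ q) {{ℕ.m*n≢0 4 (suc l ℕ.^ q) {{_}} {{ℕ.m^n≢0 (suc l) q}}}}) ⟨
  suc (ℕ.pred (4 ℕ.* suc l ℕ.^ q)) ℕ.* suc k ℕ.^ q  ≤⟨ 2^-dominates (ℕ.pred (4 ℕ.* suc l ℕ.^ q)) q (suc k) j₀≤ ⟩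
  2 ℕ.* 2 ℕ.^ k                           ≤⟨ ℕ.*-monoʳ-≤ 2 2^k≤2n ⟩
  2 ℕ.* (2 ℕ.* n)                         ≡⟨ ℕ.*-assoc 2 2 n ⟨
  4 ℕ.* n                                 ∎)
  where
  open ℕ.≤-Reasoning

module _ (R : CompleteOrderedField) where

  open RealNotions R
  open CommutativeRing commutativeRing
    using (setoid; refl; sym; trans; +-cong; +-congˡ; +-congʳ; +-comm; +-assoc; +-identityˡ; +-identityʳ;
      *-cong; *-congˡ; *-congʳ; *-comm; *-assoc; *-identityˡ; *-identityʳ; zeroˡ; zeroʳ; distribˡ; distribʳ;
      -‿cong; -‿inverseʳ; semiring; commutativeSemiring; ring)
  open import Algebra.Properties.Semiring.Mult semiring using (×-homo-+; ×1-homo-*)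
  open import Algebra.Properties.Ring ring
    using (-‿distribˡ-*; -‿distribʳ-*; -‿involutive; -0#≈0#; -‿+-comm)
  open import Relation.Binary.Reasoning.Setoid setoid

  -- The integers inside the field, and a ring solver with integer coefficients

  fromℕ-+ : ∀ m n → fromℕ (m ℕ.+ n) ≈ fromℕ m + fromℕ n
  fromℕ-+ = ×-homo-+ 1#

  fromℕ-* : ∀ m n → fromℕ (m ℕ.* n) ≈ fromℕ m * fromℕ n
  fromℕ-* = ×1-homo-*

  fromℤ-⊖ : ∀ m n → fromℤ (m ℤ.⊖ n) ≈ fromℕ m - fromℕ n
  fromℤ-⊖ m       zero    = sym (trans (+-congˡ -0#≈0#) (+-identityʳ _))
  fromℤ-⊖ zero    (suc n) = sym (+-identityˡ _)
  fromℤ-⊖ (suc m) (suc n) rewrite ℤ.[1+m]⊖[1+n]≡m⊖n m n = begin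
    fromℤ (m ℤ.⊖ n)                          ≈⟨ fromℤ-⊖ m n ⟩
    fromℕ m - fromℕ n                        ≈⟨ +-congʳ (+-identityʳ _) ⟨
    fromℕ m + 0# - fromℕ n                   ≈⟨ +-congʳ (+-congˡ (-‿inverseʳ 1#)) ⟨
    fromℕ m + (1# - 1#) - fromℕ n            ≈⟨ +-congʳ (+-assoc _ _ _) ⟨
    fromℕ m + 1# - 1# - fromℕ n              ≈⟨ +-congʳ (+-congʳ (+-comm _ _)) ⟩
    1# + fromℕ m - 1# - fromℕ n              ≈⟨ +-assoc _ _ _ ⟩
    1# + fromℕ m + (- 1# - fromℕ n)          ≈⟨ +-congˡ (-‿+-comm _ _) ⟩
    1# + fromℕ m - (1# + fromℕ n)            ∎

  fromℤ-+ : ∀ i j → fromℤ (i ℤ.+ j) ≈ fromℤ i + fromℤ j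
  fromℤ-+ (+ m)    (+ n)    = fromℕ-+ m n
  fromℤ-+ (+ m)    -[1+ n ] = fromℤ-⊖ m (suc n)
  fromℤ-+ -[1+ m ] (+ n)    = trans (fromℤ-⊖ n (suc m)) (+-comm _ _)
  fromℤ-+ -[1+ m ] -[1+ n ] = begin
    - fromℕ (suc (suc (m ℕ.+ n)))      ≡⟨ ≡.cong (λ k → - fromℕ (suc k)) (ℕ.+-suc m n) ⟨
    - fromℕ (suc m ℕ.+ suc n)          ≈⟨ -‿cong (fromℕ-+ (suc m) (suc n)) ⟩
    - (fromℕ (suc m) + fromℕ (suc n))  ≈⟨ -‿+-comm _ _ ⟨
    - fromℕ (suc m) - fromℕ (suc n)    ∎

  fromℤ-neg : ∀ i → fromℤ (ℤ.- i) ≈ - fromℤ i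
  fromℤ-neg (+ zero)  = sym -0#≈0#
  fromℤ-neg (+ suc n) = refl
  fromℤ-neg -[1+ n ]  = sym (-‿involutive _)

  fromℤ-pos-* : ∀ m j → fromℤ (+ m ℤ.* j) ≈ fromℕ m * fromℤ j
  fromℤ-pos-* m (+ n)    = begin
    fromℤ (+ m ℤ.* + n)               ≡⟨ ≡.cong fromℤ (ℤ.pos-* m n) ⟨
    fromℕ (m ℕ.* n)                   ≈⟨ fromℕ-* m n ⟩
    fromℕ m * fromℕ n                 ∎
  fromℤ-pos-* m -[1+ n ] = begin
    fromℤ (+ m ℤ.* ℤ.- (+ suc n))     ≡⟨ ≡.cong fromℤ (ℤ.neg-distribʳ-* (+ m) (+ suc n)) ⟨
    fromℤ (ℤ.- (+ m ℤ.* + suc n))     ≈⟨ fromℤ-neg (+ m ℤ.* + suc n) ⟩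
    - fromℤ (+ m ℤ.* + suc n)         ≈⟨ -‿cong (fromℤ-pos-* m (+ suc n)) ⟩
    - (fromℕ m * fromℕ (suc n))       ≈⟨ -‿distribʳ-* _ _ ⟩
    fromℕ m * - fromℕ (suc n)         ∎

  fromℤ-* : ∀ i j → fromℤ (i ℤ.* j) ≈ fromℤ i * fromℤ j
  fromℤ-* (+ m)    j = fromℤ-pos-* m j
  fromℤ-* -[1+ m ] j = begin
    fromℤ (ℤ.- (+ suc m) ℤ.* j)       ≡⟨ ≡.cong fromℤ (ℤ.neg-distribˡ-* (+ suc m) j) ⟨
    fromℤ (ℤ.- (+ suc m ℤ.* j))       ≈⟨ fromℤ-neg (+ suc m ℤ.* j) ⟩
    - fromℤ (+ suc m ℤ.* j)           ≈⟨ -‿cong (fromℤ-pos-* (suc m) j) ⟩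
    - (fromℕ (suc m) * fromℤ j)       ≈⟨ -‿distribˡ-* _ _ ⟩
    - fromℕ (suc m) * fromℤ j         ∎

  -- fromℤ, except that the coefficient 1 denotes 1# rather than 1# + 0#, so that
  -- 1# can occur in the equations passed to the solver.
  coefficient : ℤ → Carrier
  coefficient (+ 1) = 1#
  coefficient i     = fromℤ i

  coefficient≈fromℤ : ∀ i → coefficient i ≈ fromℤ i
  coefficient≈fromℤ (+ 0)           = refl
  coefficient≈fromℤ (+ 1)           = sym (+-identityʳ 1#)
  coefficient≈fromℤ (+ suc (suc n)) = refl
  coefficient≈fromℤ -[1+ n ]        = refl

  ℤ-morphism : ℤ.+-*-rawRing -Raw-AlmostCommutative⟶ fromCommutativeRing commutativeRing
  ℤ-morphism = record
    { ⟦_⟧    = coefficient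
    ; +-homo = λ i j → transport (i ℤ.+ j) (trans (fromℤ-+ i j)
        (+-cong (sym (coefficient≈fromℤ i)) (sym (coefficient≈fromℤ j))))
    ; *-homo = λ i j → transport (i ℤ.* j) (trans (fromℤ-* i j)
        (*-cong (sym (coefficient≈fromℤ i)) (sym (coefficient≈fromℤ j))))
    ; -‿homo = λ i → transport (ℤ.- i) (trans (fromℤ-neg i) (-‿cong (sym (coefficient≈fromℤ i))))
    ; 0-homo = refl
    ; 1-homo = refl
    }
    where
    transport : ∀ i {x} → fromℤ i ≈ x → coefficient i ≈ x
    transport i = trans (coefficient≈fromℤ i)

  coefficient≟ : ∀ i j → Maybe (coefficient i ≈ coefficient j)
  coefficient≟ i j with i ℤ.≟ j
  ... | yes ≡.refl = just refl
  ... | no  _      = nothing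

  open import Algebra.Solver.Ring ℤ.+-*-rawRing (fromCommutativeRing commutativeRing)
    ℤ-morphism coefficient≟ using (solve; con; _:+_; _:*_; _:-_; :-_; _:=_)

  -- Order and linear arithmetic

  decTotalOrder : DecTotalOrder 0ℓ 0ℓ 0ℓ
  decTotalOrder = record { isDecTotalOrder = isDecTotalOrder }
  open DecTotalOrder decTotalOrder using (total; antisym)
    renaming (refl to ≤-refl; trans to ≤-trans; reflexive to ≤-reflexive)
  open import Relation.Binary.Properties.DecTotalOrder decTotalOrder
    using (<-trans; <⇒≱)
  open import Relation.Binary.Properties.TotalOrder (DecTotalOrder.totalOrder decTotalOrder)
    using (≰⇒>)
  open import Relation.Binary.Construct.NonStrictToStrict _≈_ _≤_ as Strict using ()

  <⇒≤ : ∀ {x y} → x < y → x ≤ y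
  <⇒≤ = proj₁

  ≤-<-trans : ∀ {x y z} → x ≤ y → y < z → x < z
  ≤-<-trans = Strict.≤-<-trans ≤-trans antisym (λ e p → ≤-trans (≤-reflexive (sym e)) p)

  <-≤-trans : ∀ {x y z} → x < y → y ≤ z → x < z
  <-≤-trans = Strict.<-≤-trans sym ≤-trans antisym (λ e p → ≤-trans p (≤-reflexive e))

  ≤-cong : ∀ {x y x′ y′} → x ≈ x′ → y ≈ y′ → x ≤ y → x′ ≤ y′
  ≤-cong p q r = ≤-trans (≤-reflexive (sym p)) (≤-trans r (≤-reflexive q))

  <-cong : ∀ {x y x′ y′} → x ≈ x′ → y ≈ y′ → x < y → x′ < y′
  <-cong p q r = ≤-<-trans (≤-reflexive (sym p)) (<-≤-trans r (≤-reflexive q))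

  -- Linear arithmetic: hypotheses are added up with the operators ⊕ below, and
  -- the ring solver checks that the difference of the two sides is the right one.
  ≤-by : ∀ {p q a b} → p ≤ q → q - p ≈ b - a → a ≤ b
  ≤-by {p} {q} {a} {b} h e = ≤-cong
    (solve 2 (λ a p → (a :- p) :+ p := a) refl a p)
    (trans (solve 3 (λ a p q → (a :- p) :+ q := a :+ (q :- p)) refl a p q)
      (trans (+-congˡ e) (solve 2 (λ a b → a :+ (b :- a) := b) refl a b)))
    (+-monoʳ-≤ (a - p) h)

  <-by : ∀ {p q a b} → p < q → q - p ≈ b - a → a < b
  <-by {p} {q} {a} {b} (h , p≉q) e = ≤-by h e , λ a≈b → p≉q (begin
    p               ≈⟨ solve 2 (λ p a → p := p :+ (a :- a)) refl p a ⟩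
    p + (a - a)     ≈⟨ +-congˡ (+-congʳ a≈b) ⟩
    p + (b - a)     ≈⟨ +-congˡ e ⟨
    p + (q - p)     ≈⟨ solve 2 (λ p q → p :+ (q :- p) := q) refl p q ⟩
    q               ∎)

  infixr 5 _⊕_ _⊕<_ _<⊕_

  _⊕_ : ∀ {a b c d} → a ≤ b → c ≤ d → a + c ≤ b + d
  _⊕_ {a} {b} {c} {d} p q = ≤-trans (+-monoʳ-≤ a q)
    (≤-cong (+-comm _ _) (+-comm _ _) (+-monoʳ-≤ d p))

  _⊕<_ : ∀ {a b c d} → a ≤ b → c < d → a + c < b + d
  _⊕<_ {a} {b} {c} {d} p q = <-≤-trans
    (<-by q (solve 3 (λ a c d → d :- c := (a :+ d) :- (a :+ c)) refl a c d)) (p ⊕ ≤-refl)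

  _<⊕_ : ∀ {a b c d} → a < b → c ≤ d → a + c < b + d
  _<⊕_ {a} {b} {c} {d} p q = <-cong (+-comm _ _) (+-comm _ _) (q ⊕< p)

  0≤-diff : ∀ {x y} → x ≤ y → 0# ≤ y - x
  0≤-diff {x} {y} h = ≤-by h (solve 2 (λ x y → y :- x := (y :- x) :- con (+ 0)) refl x y)

  0<-diff : ∀ {x y} → x < y → 0# < y - x
  0<-diff {x} {y} h = <-by h (solve 2 (λ x y → y :- x := (y :- x) :- con (+ 0)) refl x y)

  *-monoˡ-≤ : ∀ {k x y} → 0# ≤ k → x ≤ y → k * x ≤ k * y
  *-monoˡ-≤ {k} {x} {y} 0≤k x≤y = ≤-by (*-nonNegative 0≤k (0≤-diff x≤y))
    (solve 3 (λ k x y → k :* (y :- x) :- con (+ 0) := k :* y :- k :* x) refl k x y)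

  *-mono-≤ : ∀ {x y u v} → 0# ≤ x → x ≤ y → 0# ≤ u → u ≤ v → x * u ≤ y * v
  *-mono-≤ 0≤x x≤y 0≤u u≤v = ≤-trans (*-monoˡ-≤ 0≤x u≤v)
    (≤-cong (*-comm _ _) (*-comm _ _) (*-monoˡ-≤ (≤-trans 0≤u u≤v) x≤y))

  *-pos : ∀ {x y} → 0# < x → 0# < y → 0# < x * y
  *-pos {x} {y} (0≤x , 0≉x) (0≤y , 0≉y) = *-nonNegative 0≤x 0≤y , λ 0≈xy → 0≉y (begin
    0#                ≈⟨ zeroˡ _ ⟨
    0# * x ⁻¹         ≈⟨ *-congʳ 0≈xy ⟩
    x * y * x ⁻¹      ≈⟨ solve 3 (λ x y i → x :* y :* i := x :* i :* y) refl x y (x ⁻¹) ⟩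
    x * x ⁻¹ * y      ≈⟨ *-congʳ (⁻¹-inverseʳ x (λ e → 0≉x (sym e))) ⟩
    1# * y            ≈⟨ *-identityˡ y ⟩
    y                 ∎)

  *-monoˡ-< : ∀ {k x y} → 0# < k → x < y → k * x < k * y
  *-monoˡ-< {k} {x} {y} 0<k x<y = <-by (*-pos 0<k (0<-diff x<y))
    (solve 3 (λ k x y → k :* (y :- x) :- con (+ 0) := k :* y :- k :* x) refl k x y)

  0≤1 : 0# ≤ 1#
  0≤1 with total 0# 1#
  ... | inj₁ h = h
  ... | inj₂ h = ≤-cong refl (solve 0 (:- con (+ 1) :* :- con (+ 1) := con (+ 1)) refl) (*-nonNegative 0≤-1 0≤-1)
    where
    0≤-1 : 0# ≤ - 1#
    0≤-1 = ≤-by h (solve 0 (con (+ 0) :- con (+ 1) := (:- con (+ 1)) :- con (+ 0)) refl)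

  0<1 : 0# < 1#
  0<1 = 0≤1 , 0≉1

  0≤fromℕ : ∀ n → 0# ≤ fromℕ n
  0≤fromℕ zero    = ≤-refl
  0≤fromℕ (suc n) = ≤-cong (+-identityʳ 0#) refl (0≤1 ⊕ 0≤fromℕ n)

  fromℕ-mono-≤ : ∀ {m n} → m ℕ.≤ n → fromℕ m ≤ fromℕ n
  fromℕ-mono-≤ {n = n} ℕ.z≤n = 0≤fromℕ n
  fromℕ-mono-≤ (ℕ.s≤s h)    = +-monoʳ-≤ 1# (fromℕ-mono-≤ h)

  n<1+n : ∀ x → x < 1# + x
  n<1+n x = <-by 0<1 (solve 1 (λ x → con (+ 1) :- con (+ 0) := con (+ 1) :+ x :- x) refl x)

  fromℕ-mono-< : ∀ {m n} → m ℕ.< n → fromℕ m < fromℕ n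
  fromℕ-mono-< h = <-≤-trans (n<1+n _) (fromℕ-mono-≤ h)

  fromℕ-cancel-< : ∀ {m n} → fromℕ m < fromℕ n → m ℕ.< n
  fromℕ-cancel-< h = ℕ.≰⇒> λ n≤m → <⇒≱ h (fromℕ-mono-≤ n≤m)

  fromℕ-cancel-≤ : ∀ {m n} → fromℕ m ≤ fromℕ n → m ℕ.≤ n
  fromℕ-cancel-≤ h = ℕ.≮⇒≥ λ n<m → <⇒≱ (fromℕ-mono-< n<m) h

  0<fromℕ : ∀ {n} → 0 ℕ.< n → 0# < fromℕ n
  0<fromℕ = fromℕ-mono-<

  fromℕ-1 : fromℕ 1 ≈ 1#
  fromℕ-1 = +-identityʳ 1#

  1≤fromℕ : ∀ {n} → 1 ℕ.≤ n → 1# ≤ fromℕ n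
  1≤fromℕ h = ≤-cong fromℕ-1 refl (fromℕ-mono-≤ h)

  ≉0 : ∀ {x} → 0# < x → ¬ (x ≈ 0#)
  ≉0 (_ , 0≉x) e = 0≉x (sym e)

  ⁻¹-inverseˡ : ∀ {x} → 0# < x → x ⁻¹ * x ≈ 1#
  ⁻¹-inverseˡ 0<x = trans (*-comm _ _) (⁻¹-inverseʳ _ (≉0 0<x))

  ⁻¹-pos : ∀ {x} → 0# < x → 0# < x ⁻¹
  ⁻¹-pos {x} 0<x = ≰⇒> λ x⁻¹≤0 → <⇒≱ 0<1
    (≤-cong (⁻¹-inverseʳ x (≉0 0<x)) (zeroʳ x) (*-monoˡ-≤ (<⇒≤ 0<x) x⁻¹≤0))

  ½ : Carrier
  ½ = 1# / fromℕ 2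

  ½+½ : ½ + ½ ≈ 1#
  ½+½ = begin
    1# * fromℕ 2 ⁻¹ + 1# * fromℕ 2 ⁻¹
      ≈⟨ solve 1 (λ i → con (+ 1) :* i :+ con (+ 1) :* i := con (+ 2) :* i) refl (fromℕ 2 ⁻¹) ⟩
    fromℕ 2 * fromℕ 2 ⁻¹
      ≈⟨ ⁻¹-inverseʳ _ (≉0 (0<fromℕ {2} (ℕ.s≤s ℕ.z≤n))) ⟩
    1# ∎

  0<½ : 0# < ½
  0<½ = *-pos 0<1 (⁻¹-pos (0<fromℕ {2} (ℕ.s≤s ℕ.z≤n)))

  <-dense : ∀ {x y} → x < y → ∃[ z ] x < z × z < y
  <-dense {x} {y} x<y = x + ½ * (y - x)
    , <-by 0<d (solve 2 (λ x d → d :- con (+ 0) := x :+ d :- x) refl x d)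
    , <-by 0<d (begin
        d - 0#                ≈⟨ solve 1 (λ d → d :- con (+ 0) := d) refl d ⟩
        d                     ≈⟨ solve 3 (λ x y h → h :* (y :- x) := (h :+ h) :* (y :- x) :+ x :- (x :+ h :* (y :- x))) refl x y ½ ⟩
        (½ + ½) * (y - x) + x - (x + d)   ≈⟨ +-congʳ (+-congʳ (*-congʳ ½+½)) ⟩
        1# * (y - x) + x - (x + d)        ≈⟨ solve 3 (λ x y d → con (+ 1) :* (y :- x) :+ x :- (x :+ d) := y :- (x :+ d)) refl x y d ⟩
        y - (x + d)           ∎)
    where
    d = ½ * (y - x)
    0<d = *-pos 0<½ (0<-diff x<y)

  -- Suprema and the Archimedean property

  sup-upper : ∀ (P : Pred Carrier 0ℓ) {u} → (∀ x → P x → x ≤ u) → ∀ {x} → P x → x ≤ sup P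
  sup-upper P bd {x} Px = proj₁ (sup-supremum P (x , Px) (_ , bd)) x Px

  sup-least : ∀ (P : Pred Carrier 0ℓ) {u} → ∃ P → (∀ x → P x → x ≤ u) → sup P ≤ u
  sup-least P {u} ne bd with sup P ≤? u
  ... | yes h = h
  ... | no  h with proj₂ (sup-supremum P ne (u , bd)) u (≰⇒> h)
  ...   | x , Px , u<x = contradiction (bd x Px) (<⇒≱ u<x)

  NaturalsUpTo : Carrier → Pred Carrier 0ℓ
  NaturalsUpTo b x = ∃[ n ] x ≈ fromℕ n × fromℕ n ≤ b

  NaturalsUpTo-bounded : ∀ b x → NaturalsUpTo b x → x ≤ b
  NaturalsUpTo-bounded b x (n , x≈n , n≤b) = ≤-cong (sym x≈n) refl n≤b

  sup-approached : ∀ (P : Pred Carrier 0ℓ) {u} → ∃ P → (∀ x → P x → x ≤ u) →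
    ∃[ x ] P x × sup P < x + 1#
  sup-approached P ne bd =
    let x , Px , h = proj₂ (sup-supremum P ne (_ , bd)) (sup P - 1#)
          (<-by 0<1 (solve 1 (λ s → con (+ 1) :- con (+ 0) := s :- (s :- con (+ 1))) refl (sup P)))
    in x , Px , <-by h (solve 2 (λ s x → x :- (s :- con (+ 1)) := x :+ con (+ 1) :- s) refl (sup P) x)

  abstract
    -- Some natural number `n` below `b` lies within 1 of the supremum of all of them; then `suc n`
    -- exceeds that supremum, hence also `b`.
    floor-nonNegative : ∀ {b} → 0# ≤ b → ∃[ n ] fromℕ n ≤ b × b < fromℕ (suc n)
    floor-nonNegative {b} 0≤b =
      let x , (n , x≈n , n≤b) , sup<x+1 =
            sup-approached (NaturalsUpTo b) (0# , 0 , refl , 0≤b) (NaturalsUpTo-bounded b)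
      in n , n≤b , ≰⇒> λ 1+n≤b → <⇒≱
        (<-cong refl (trans (+-congʳ x≈n) (+-comm (fromℕ n) 1#)) sup<x+1)
        (sup-upper (NaturalsUpTo b) (NaturalsUpTo-bounded b) (suc n , refl , 1+n≤b))

    archimedean : ∀ b → ∃[ n ] b < fromℕ n
    archimedean b with 0# ≤? b
    ... | yes 0≤b = let n , _ , h = floor-nonNegative 0≤b in suc n , h
    ... | no  0≰b = 0 , ≰⇒> 0≰b

  -- Integers, floors and Hermite's identity

  -- Integers stay elements of the field, singled out by a predicate, so that floors and reals mix
  -- in one inequality without coercions and the solver applies.
  IsInteger : Pred Carrier 0ℓ
  IsInteger x = ∃[ k ] x ≈ fromℤ k

  IsInteger-resp-≈ : ∀ {x y} → x ≈ y → IsInteger x → IsInteger y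
  IsInteger-resp-≈ x≈y (k , e) = k , trans (sym x≈y) e

  IsInteger-+ : ∀ {x y} → IsInteger x → IsInteger y → IsInteger (x + y)
  IsInteger-+ (k , e) (l , f) = k ℤ.+ l , trans (+-cong e f) (sym (fromℤ-+ k l))

  IsInteger-neg : ∀ {x} → IsInteger x → IsInteger (- x)
  IsInteger-neg (k , e) = ℤ.- k , trans (-‿cong e) (sym (fromℤ-neg k))

  IsInteger-- : ∀ {x y} → IsInteger x → IsInteger y → IsInteger (x - y)
  IsInteger-- p q = IsInteger-+ p (IsInteger-neg q)

  IsInteger-fromℕ : ∀ n → IsInteger (fromℕ n)
  IsInteger-fromℕ n = + n , refl

  IsInteger-1 : IsInteger 1#
  IsInteger-1 = + 1 , sym fromℕ-1

  -- The bridge from estimates to equations: floors, indicator values and the final contradiction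
  -- are all pinned down by it.
  IsInteger-discrete : ∀ {x} → IsInteger x → - 1# < x → x < 1# → x ≈ 0#
  IsInteger-discrete (+ zero , e)  _ _ = e
  IsInteger-discrete (+ suc n , e) _ h =
    contradiction (≤-cong refl (sym e) (1≤fromℕ {suc n} (ℕ.s≤s ℕ.z≤n))) (<⇒≱ h)
  IsInteger-discrete (-[1+ n ] , e) h _ = contradiction
    (≤-cong (sym e) refl (≤-by (1≤fromℕ {suc n} (ℕ.s≤s ℕ.z≤n))
      (solve 1 (λ k → k :- con (+ 1) := (:- con (+ 1)) :- (:- k)) refl (fromℕ (suc n)))))
    (<⇒≱ h)

  ∃-floor : ∀ y → ∃[ k ] IsInteger k × k ≤ y × y < k + 1#
  ∃-floor y with 0# ≤? y
  ... | yes 0≤y =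
    let n , p , q = floor-nonNegative 0≤y in
    fromℕ n , IsInteger-fromℕ n , p , <-cong refl (+-comm _ _) q
  ... | no  0≰y =
    let m , h     = archimedean (- y)
        M         = fromℕ m
        n , p , q = floor-nonNegative
          (≤-by (<⇒≤ h) (solve 2 (λ y M → M :- (:- y) := y :+ M :- con (+ 0)) refl y M))
        N         = fromℕ n
    in N - M , IsInteger-- (IsInteger-fromℕ n) (IsInteger-fromℕ m)
     , ≤-by p (solve 3 (λ y N M → y :+ M :- N := y :- (N :- M)) refl y N M)
     , <-by q (solve 3 (λ y N M → con (+ 1) :+ N :- (y :+ M) := N :- M :+ con (+ 1) :- y) refl y N M)

  ⌊_⌋ : Carrier → Carrier
  ⌊ y ⌋ = proj₁ (∃-floor y)

  ⌊⌋-integer : ∀ y → IsInteger ⌊ y ⌋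
  ⌊⌋-integer y = proj₁ (proj₂ (∃-floor y))

  ⌊⌋-≤ : ∀ y → ⌊ y ⌋ ≤ y
  ⌊⌋-≤ y = proj₁ (proj₂ (proj₂ (∃-floor y)))

  <-⌊⌋+1 : ∀ y → y < ⌊ y ⌋ + 1#
  <-⌊⌋+1 y = proj₂ (proj₂ (proj₂ (∃-floor y)))

  ⌊⌋-unique : ∀ {k y} → IsInteger k → k ≤ y → y < k + 1# → ⌊ y ⌋ ≈ k
  ⌊⌋-unique {k} {y} ik p q = begin
    f            ≈⟨ solve 2 (λ f k → f := f :- k :+ k) refl f k ⟩
    f - k + k    ≈⟨ +-congʳ f-k≈0 ⟩
    0# + k       ≈⟨ +-identityˡ k ⟩
    k            ∎
    where
    f = ⌊ y ⌋
    f-k≈0 : f - k ≈ 0#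
    f-k≈0 = IsInteger-discrete (IsInteger-- (⌊⌋-integer y) ik)
      (<-by (p ⊕< <-⌊⌋+1 y) (solve 3 (λ y f k → y :+ (f :+ con (+ 1)) :- (k :+ y) := f :- k :- (:- con (+ 1))) refl y f k))
      (<-by (⌊⌋-≤ y ⊕< q) (solve 3 (λ y f k → y :+ (k :+ con (+ 1)) :- (f :+ y) := con (+ 1) :- (f :- k)) refl y f k))

  ⌊⌋-greatest : ∀ {k y} → IsInteger k → k ≤ y → k ≤ ⌊ y ⌋
  ⌊⌋-greatest {k} {y} ik k≤y with k ≤? ⌊ y ⌋
  ... | yes h = h
  ... | no  h = ≤-reflexive (sym (⌊⌋-unique ik k≤y (<-by (<-⌊⌋+1 y <⊕ <⇒≤ (≰⇒> h))
    (solve 3 (λ y f k → f :+ con (+ 1) :+ k :- (y :+ f) := k :+ con (+ 1) :- y) refl y ⌊ y ⌋ k))))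

  ⌊⌋-cong : ∀ {x y} → x ≈ y → ⌊ x ⌋ ≈ ⌊ y ⌋
  ⌊⌋-cong {x} {y} e = ⌊⌋-unique (⌊⌋-integer y) (≤-cong refl (sym e) (⌊⌋-≤ y)) (<-cong (sym e) refl (<-⌊⌋+1 y))

  ⌊⌋-+-integer : ∀ y {k} → IsInteger k → ⌊ y + k ⌋ ≈ ⌊ y ⌋ + k
  ⌊⌋-+-integer y {k} ik = ⌊⌋-unique (IsInteger-+ (⌊⌋-integer y) ik) (⌊⌋-≤ y ⊕ ≤-refl)
    (<-by (<-⌊⌋+1 y) (solve 3 (λ y f k → f :+ con (+ 1) :- y := f :+ k :+ con (+ 1) :- (y :+ k)) refl y ⌊ y ⌋ k))

  IsInteger-<⇒+1≤ : ∀ {k l} → IsInteger k → IsInteger l → k < l → k + 1# ≤ l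
  IsInteger-<⇒+1≤ {k} {l} ik il k<l with k + 1# ≤? l
  ... | yes h = h
  ... | no  h = contradiction
    (IsInteger-discrete (IsInteger-- il ik)
      (<-by (k<l <⊕ 0≤1) (solve 2 (λ k l → l :+ con (+ 1) :- (k :+ con (+ 0)) := l :- k :- (:- con (+ 1))) refl k l))
      (<-by (≰⇒> h) (solve 2 (λ k l → k :+ con (+ 1) :- l := con (+ 1) :- (l :- k)) refl k l)))
    (≉0 (0<-diff k<l))

  -- The left side is an integer, so it suffices to trap `y + y` above it by less than 1. Both
  -- bounds split on `g ≤ f`, that is, on whether the fractional part of `y` is below 1/2.
  hermite : ∀ y → ⌊ y ⌋ + ⌊ y + ½ ⌋ ≈ ⌊ y + y ⌋
  hermite y = sym (⌊⌋-unique (IsInteger-+ (⌊⌋-integer y) (⌊⌋-integer (y + ½))) lower upper)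
    where
    f = ⌊ y ⌋
    g = ⌊ y + ½ ⌋
    f+1≤g : ¬ (g ≤ f) → f + 1# ≤ g
    f+1≤g h = IsInteger-<⇒+1≤ (⌊⌋-integer y) (⌊⌋-integer (y + ½)) (≰⇒> h)
    lower : f + g ≤ y + y
    lower with g ≤? f
    ... | yes g≤f = ⌊⌋-≤ y ⊕ ≤-trans g≤f (⌊⌋-≤ y)
    ... | no  g≰f = ≤-by (f+1≤g g≰f ⊕ ⌊⌋-≤ (y + ½) ⊕ ⌊⌋-≤ (y + ½) ⊕ ≤-reflexive ½+½)
      (solve 4 (λ y h f g → g :+ (y :+ h :+ (y :+ h :+ con (+ 1))) :- (f :+ con (+ 1) :+ (g :+ (g :+ (h :+ h))))
        := y :+ y :- (f :+ g)) refl y ½ f g)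
    upper : y + y < f + g + 1#
    upper with g ≤? f
    ... | yes g≤f = <-by (<-⌊⌋+1 (y + ½) <⊕ <⇒≤ (<-⌊⌋+1 (y + ½)) ⊕ g≤f ⊕ ≤-reflexive (sym ½+½))
      (solve 4 (λ y h f g → g :+ con (+ 1) :+ (g :+ con (+ 1) :+ (f :+ (h :+ h))) :- (y :+ h :+ (y :+ h :+ (g :+ con (+ 1))))
        := f :+ g :+ con (+ 1) :- (y :+ y)) refl y ½ f g)
    ... | no  g≰f = <-by (<-⌊⌋+1 y <⊕ <⇒≤ (<-⌊⌋+1 y) ⊕ f+1≤g g≰f)
      (solve 3 (λ y f g → f :+ con (+ 1) :+ (f :+ con (+ 1) :+ g) :- (y :+ (y :+ (f :+ con (+ 1))))
        := f :+ g :+ con (+ 1) :- (y :+ y)) refl y f g)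

  -- Absolute value and distance to the nearest integer

  x≤∣x∣ : ∀ x → x ≤ ∣ x ∣
  x≤∣x∣ x with 0# ≤? x
  ... | yes 0≤x = ≤-refl
  ... | no  0≰x = let x≤0 = <⇒≤ (≰⇒> 0≰x) in
    ≤-by (x≤0 ⊕ x≤0) (solve 1 (λ x → con (+ 0) :+ con (+ 0) :- (x :+ x) := (:- x) :- x) refl x)

  -x≤∣x∣ : ∀ x → - x ≤ ∣ x ∣
  -x≤∣x∣ x with 0# ≤? x
  ... | yes 0≤x = ≤-by (0≤x ⊕ 0≤x) (solve 1 (λ x → x :+ x :- (con (+ 0) :+ con (+ 0)) := x :- (:- x)) refl x)
  ... | no  0≰x = ≤-refl

  0≤∣x∣ : ∀ x → 0# ≤ ∣ x ∣
  0≤∣x∣ x with 0# ≤? x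
  ... | yes 0≤x = 0≤x
  ... | no  0≰x = ≤-by (<⇒≤ (≰⇒> 0≰x)) (solve 1 (λ x → con (+ 0) :- x := (:- x) :- con (+ 0)) refl x)

  ∣x∣≤ : ∀ {x r} → x ≤ r → - x ≤ r → ∣ x ∣ ≤ r
  ∣x∣≤ {x} p q with 0# ≤? x
  ... | yes _ = p
  ... | no  _ = q

  ∣x∣< : ∀ {x r} → x < r → - x < r → ∣ x ∣ < r
  ∣x∣< {x} p q with 0# ≤? x
  ... | yes _ = p
  ... | no  _ = q

  -- The set of negated distances that `inf` hands to `sup`: by definition `‖ y ‖` is
  -- `- sup (Distances y)`.
  Distances : Carrier → Pred Carrier 0ℓ
  Distances y z = ∃[ k ] - z ≈ ∣ y - fromℤ k ∣

  ∈Distances : ∀ y k → Distances y (- ∣ y - fromℤ k ∣)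
  ∈Distances y k = k , solve 1 (λ a → :- (:- a) := a) refl ∣ y - fromℤ k ∣

  ‖‖-greatest : ∀ {y u} → (∀ k → u ≤ ∣ y - fromℤ k ∣) → u ≤ ‖ y ‖
  ‖‖-greatest {y} {u} h =
    ≤-by (sup-least (Distances y) {u = - u} (_ , ∈Distances y (+ 0)) λ z (k , e) →
           ≤-by (≤-cong refl (sym e) (h k)) (solve 2 (λ u z → (:- z) :- u := (:- u) :- z) refl u z))
      (solve 2 (λ u s → (:- u) :- s := (:- s) :- u) refl u (sup (Distances y)))

  ‖‖≤ : ∀ y k → ‖ y ‖ ≤ ∣ y - fromℤ k ∣
  ‖‖≤ y k =
    ≤-by (sup-upper (Distances y) (λ z (l , e) →
           ≤-by (≤-cong refl (sym e) (0≤∣x∣ (y - fromℤ l))) (solve 1 (λ z → (:- z) :- con (+ 0) := con (+ 0) :- z) refl z))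
           (∈Distances y k))
      (solve 2 (λ s a → s :- (:- a) := a :- (:- s)) refl (sup (Distances y)) ∣ y - fromℤ k ∣)

  -- Since `‖ y ‖` is an infimum, the argument is by contraposition and needs no nearest integer. If
  -- `f` falls short of `y - r`, then `f` and `f + 1#` enclose the whole interval, every integer is
  -- at least as far from `y` as one of these two, and the smaller of their distances exceeds `r`.
  ⌊⌋-near : ∀ {y r} → ‖ y ‖ ≤ r → y - r ≤ ⌊ y + r ⌋
  ⌊⌋-near {y} {r} h with y - r ≤? ⌊ y + r ⌋
  ... | yes p = p
  ... | no  p = contradiction h (<⇒≱ r<‖y‖)
    where
    f = ⌊ y + r ⌋
    r<y-f : r < y - f
    r<y-f = <-by (≰⇒> p) (solve 3 (λ y r f → y :- r :- f := y :- f :- r) refl y r f)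
    r<f+1-y : r < f + 1# - y
    r<f+1-y = <-by (<-⌊⌋+1 (y + r)) (solve 3 (λ y r f → f :+ con (+ 1) :- (y :+ r) := f :+ con (+ 1) :- y :- r) refl y r f)
    far : ∀ {u} → u ≤ y - f → u ≤ f + 1# - y → ∀ k → u ≤ ∣ y - fromℤ k ∣
    far {u} u≤ u≤′ k with fromℤ k ≤? f
    ... | yes k≤f = ≤-trans
      (≤-by (u≤ ⊕ k≤f) (solve 4 (λ u y f k → y :- f :+ f :- (u :+ k) := y :- k :- u) refl u y f (fromℤ k)))
      (x≤∣x∣ (y - fromℤ k))
    ... | no  k≰f = ≤-trans
      (≤-by (u≤′ ⊕ IsInteger-<⇒+1≤ (⌊⌋-integer (y + r)) (k , refl) (≰⇒> k≰f))
        (solve 4 (λ u y f k → f :+ con (+ 1) :- y :+ k :- (u :+ (f :+ con (+ 1))) := (:- (y :- k)) :- u) refl u y f (fromℤ k)))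
      (-x≤∣x∣ (y - fromℤ k))
    r<‖y‖ : r < ‖ y ‖
    r<‖y‖ with total (y - f) (f + 1# - y)
    ... | inj₁ q = <-≤-trans r<y-f (‖‖-greatest (far ≤-refl q))
    ... | inj₂ q = <-≤-trans r<f+1-y (‖‖-greatest (far q ≤-refl))

  ‖‖≤-integer : ∀ {y r k} → IsInteger k → y - r ≤ k → k ≤ y + r → ‖ y ‖ ≤ r
  ‖‖≤-integer {y} {r} {x} (k , e) p q = ≤-trans (‖‖≤ y k) (∣x∣≤
    (≤-by (≤-cong refl e p) (solve 3 (λ y r k → k :- (y :- r) := r :- (y :- k)) refl y r (fromℤ k)))
    (≤-by (≤-cong e refl q) (solve 3 (λ y r k → y :+ r :- k := r :- (:- (y :- k))) refl y r (fromℤ k))))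

  -- Counting the integers near a point

  -- The number of integers in [y - r , y + r], for r ≥ 0.
  integersNear : Carrier → Carrier → Carrier
  integersNear y r = ⌊ y + r ⌋ + ⌊ r - y ⌋ + 1#

  integersNear-cong : ∀ {y y′ r r′} → y ≈ y′ → r ≈ r′ → integersNear y r ≈ integersNear y′ r′
  integersNear-cong p q =
    +-congʳ (+-cong (⌊⌋-cong (+-cong p q)) (⌊⌋-cong (+-cong q (-‿cong p))))

  integersNear-integer : ∀ y r → IsInteger (integersNear y r)
  integersNear-integer y r =
    IsInteger-+ (IsInteger-+ (⌊⌋-integer (y + r)) (⌊⌋-integer (r - y))) IsInteger-1

  integersNear-≤ : ∀ y r → integersNear y r ≤ r + r + 1#
  integersNear-≤ y r = ≤-by (⌊⌋-≤ (y + r) ⊕ ⌊⌋-≤ (r - y))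
    (solve 4 (λ y r f g → y :+ r :+ (r :- y) :- (f :+ g) := r :+ r :+ con (+ 1) :- (f :+ g :+ con (+ 1)))
      refl y r ⌊ y + r ⌋ ⌊ r - y ⌋)

  <-integersNear : ∀ y r → r + r - 1# < integersNear y r
  <-integersNear y r = <-by (<-⌊⌋+1 (y + r) <⊕ <⇒≤ (<-⌊⌋+1 (r - y)))
    (solve 4 (λ y r f g → f :+ con (+ 1) :+ (g :+ con (+ 1)) :- (y :+ r :+ (r :- y))
      := f :+ g :+ con (+ 1) :- (r :+ r :- con (+ 1)))
      refl y r ⌊ y + r ⌋ ⌊ r - y ⌋)

  integersNear-shift : ∀ y r {k} → IsInteger k → integersNear (y + k) r ≈ integersNear y r
  integersNear-shift y r {k} ik = begin
    ⌊ y + k + r ⌋ + ⌊ r - (y + k) ⌋ + 1#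
      ≈⟨ +-congʳ (+-cong
           (⌊⌋-cong (solve 3 (λ y r k → y :+ k :+ r := y :+ r :+ k) refl y r k))
           (⌊⌋-cong (solve 3 (λ y r k → r :- (y :+ k) := r :- y :+ :- k) refl y r k))) ⟩
    ⌊ y + r + k ⌋ + ⌊ r - y + - k ⌋ + 1#
      ≈⟨ +-congʳ (+-cong (⌊⌋-+-integer (y + r) ik) (⌊⌋-+-integer (r - y) (IsInteger-neg ik))) ⟩
    ⌊ y + r ⌋ + k + (⌊ r - y ⌋ + - k) + 1#
      ≈⟨ solve 3 (λ f g k → f :+ k :+ (g :+ :- k) :+ con (+ 1) := f :+ g :+ con (+ 1)) refl ⌊ y + r ⌋ ⌊ r - y ⌋ k ⟩
    ⌊ y + r ⌋ + ⌊ r - y ⌋ + 1#  ∎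

  integersNear-neg : ∀ y r → integersNear (- y) r ≈ integersNear y r
  integersNear-neg y r = begin
    ⌊ - y + r ⌋ + ⌊ r - - y ⌋ + 1#
      ≈⟨ +-congʳ (+-cong
           (⌊⌋-cong (solve 2 (λ y r → :- y :+ r := r :- y) refl y r))
           (⌊⌋-cong (solve 2 (λ y r → r :- :- y := y :+ r) refl y r))) ⟩
    ⌊ r - y ⌋ + ⌊ y + r ⌋ + 1#
      ≈⟨ +-congʳ (+-comm _ _) ⟩
    ⌊ y + r ⌋ + ⌊ r - y ⌋ + 1#  ∎

  -- The points `y` and `y + ½` are the two preimages of `y + y` under doubling modulo 1. Hermite's
  -- identity is used at both ends of the interval, with base point `z = r - (y + ½)` for the lower
  -- end; doubling `z` releases a `- 1#` that cancels one of the two summands `1#`.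
  integersNear-double : ∀ y r →
    integersNear y r + integersNear (y + ½) r ≈ integersNear (y + y) (r + r)
  integersNear-double y r = begin
    ⌊ y + r ⌋ + ⌊ r - y ⌋ + 1# + (⌊ y + ½ + r ⌋ + ⌊ z ⌋ + 1#)
      ≈⟨ +-cong (+-congʳ (+-congˡ (⌊⌋-cong r-y≈z+½)))
                (+-congʳ (+-congʳ (⌊⌋-cong (solve 3 (λ y r h → y :+ h :+ r := y :+ r :+ h) refl y r ½)))) ⟩
    ⌊ y + r ⌋ + ⌊ z + ½ ⌋ + 1# + (⌊ y + r + ½ ⌋ + ⌊ z ⌋ + 1#)
      ≈⟨ solve 4 (λ a b c d → a :+ b :+ con (+ 1) :+ (c :+ d :+ con (+ 1))
           := (a :+ c) :+ (d :+ b) :+ con (+ 2)) refl ⌊ y + r ⌋ ⌊ z + ½ ⌋ ⌊ y + r + ½ ⌋ ⌊ z ⌋ ⟩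
    (⌊ y + r ⌋ + ⌊ y + r + ½ ⌋) + (⌊ z ⌋ + ⌊ z + ½ ⌋) + fromℕ 2
      ≈⟨ +-congʳ (+-cong (hermite (y + r)) (hermite z)) ⟩
    ⌊ y + r + (y + r) ⌋ + ⌊ z + z ⌋ + fromℕ 2
      ≈⟨ +-congʳ (+-cong (⌊⌋-cong (solve 2 (λ y r → y :+ r :+ (y :+ r) := y :+ y :+ (r :+ r)) refl y r))
           (trans (⌊⌋-cong z+z≈) (⌊⌋-+-integer (r + r - (y + y)) (IsInteger-neg IsInteger-1)))) ⟩
    ⌊ y + y + (r + r) ⌋ + (⌊ r + r - (y + y) ⌋ - 1#) + fromℕ 2
      ≈⟨ solve 2 (λ a b → a :+ (b :- con (+ 1)) :+ con (+ 2) := a :+ b :+ con (+ 1)) refl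
           ⌊ y + y + (r + r) ⌋ ⌊ r + r - (y + y) ⌋ ⟩
    ⌊ y + y + (r + r) ⌋ + ⌊ r + r - (y + y) ⌋ + 1#  ∎
    where
    z = r - (y + ½)
    r-y≈z+½ : r - y ≈ z + ½
    r-y≈z+½ = solve 3 (λ y r h → r :- y := r :- (y :+ h) :+ h) refl y r ½
    z+z≈ : z + z ≈ r + r - (y + y) - 1#
    z+z≈ = trans
      (solve 3 (λ y r h → r :- (y :+ h) :+ (r :- (y :+ h)) := r :+ r :- (y :+ y) :- (h :+ h)) refl y r ½)
      (+-congˡ (-‿cong ½+½))

  indicator : {P : Set} → Dec P → Carrier
  indicator d = if does d then 1# else 0#

  module _ {r : Carrier} (0≤r : 0# ≤ r) (r<½ : r < ½) where

    -1<integersNear : ∀ y → - 1# < integersNear y r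
    -1<integersNear y = <-by (<-integersNear y r <⊕ 0≤r ⊕ 0≤r)
      (solve 2 (λ r g → g :+ (r :+ r) :- (r :+ r :- con (+ 1) :+ (con (+ 0) :+ con (+ 0))) := g :- (:- con (+ 1)))
        refl r (integersNear y r))

    integersNear<2 : ∀ y → integersNear y r < fromℕ 2
    integersNear<2 y = <-by (integersNear-≤ y r ⊕< r<½ <⊕ <⇒≤ r<½ ⊕ ≤-reflexive ½+½)
      (solve 3 (λ r g h → r :+ r :+ con (+ 1) :+ (h :+ (h :+ con (+ 1))) :- (g :+ (r :+ (r :+ (h :+ h)))) := con (+ 2) :- g)
        refl r (integersNear y r) ½)

    -- For `r < ½` the count is an integer strictly between -1 and 2. Whether `⌊ y + r ⌋` reaches
    -- `y - r` decides between 0 and 1.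
    integersNear≈indicator : ∀ y → integersNear y r ≈ indicator (‖ y ‖ ≤? r)
    integersNear≈indicator y with ‖ y ‖ ≤? r
    ... | yes p = begin
      g               ≈⟨ solve 1 (λ g → g := g :- con (+ 1) :+ con (+ 1)) refl g ⟩
      g - 1# + 1#     ≈⟨ +-congʳ (IsInteger-discrete (IsInteger-- (integersNear-integer y r) IsInteger-1)
                           (<-by (0<1 <⊕ k≤⌊⌋) (solve 2 (λ f k → con (+ 1) :+ k :- (con (+ 0) :+ (:- f))
                             := f :+ k :+ con (+ 1) :- con (+ 1) :- (:- con (+ 1))) refl ⌊ y + r ⌋ ⌊ r - y ⌋))
                           (<-by (integersNear<2 y) (solve 1 (λ g → con (+ 2) :- g := con (+ 1) :- (g :- con (+ 1))) refl g))) ⟩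
      0# + 1#         ≈⟨ +-identityˡ 1# ⟩
      1#              ∎
      where
      g = integersNear y r
      k≤⌊⌋ : - ⌊ y + r ⌋ ≤ ⌊ r - y ⌋
      k≤⌊⌋ = ⌊⌋-greatest (IsInteger-neg (⌊⌋-integer (y + r)))
        (≤-by (⌊⌋-near p) (solve 3 (λ y r f → f :- (y :- r) := r :- y :- (:- f)) refl y r ⌊ y + r ⌋))
    ... | no  p = IsInteger-discrete (integersNear-integer y r) (-1<integersNear y)
      (<-by (≰⇒> far <⊕ ⌊⌋-≤ (r - y))
        (solve 4 (λ y r f k → y :- r :+ (r :- y) :- (f :+ k) := con (+ 1) :- (f :+ k :+ con (+ 1))) refl y r ⌊ y + r ⌋ ⌊ r - y ⌋))
      where
      far : ¬ (y - r ≤ ⌊ y + r ⌋)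
      far q = p (‖‖≤-integer (⌊⌋-integer (y + r)) q (⌊⌋-≤ (y + r)))

  -- Finite sums

  ∑ : ℕ → (ℕ → Carrier) → Carrier
  ∑ zero    f = 0#
  ∑ (suc n) f = ∑ n f + f n

  ∑-cong : ∀ n {f g} → (∀ i → i ℕ.< n → f i ≈ g i) → ∑ n f ≈ ∑ n g
  ∑-cong zero    h = refl
  ∑-cong (suc n) h = +-cong (∑-cong n λ i i<n → h i (ℕ.m<n⇒m<1+n i<n)) (h n ℕ.≤-refl)

  ∑-const : ∀ n {f c} → (∀ i → i ℕ.< n → f i ≈ c) → ∑ n f ≈ fromℕ n * c
  ∑-const zero    {c = c} h = sym (zeroˡ c)
  ∑-const (suc n) {f} {c} h = begin
    ∑ n f + f n          ≈⟨ +-cong (∑-const n λ i i<n → h i (ℕ.m<n⇒m<1+n i<n)) (h n ℕ.≤-refl) ⟩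
    fromℕ n * c + c      ≈⟨ solve 2 (λ n c → n :* c :+ c := (con (+ 1) :+ n) :* c) refl (fromℕ n) c ⟩
    fromℕ (suc n) * c    ∎

  ∑-≤ : ∀ n {f u} → (∀ i → f i ≤ u) → ∑ n f ≤ fromℕ n * u
  ∑-≤ zero    {u = u} h = ≤-reflexive (sym (zeroˡ u))
  ∑-≤ (suc n) {f} {u} h = ≤-by (∑-≤ n h ⊕ h n)
    (solve 4 (λ n u s f → n :* u :+ u :- (s :+ f) := (con (+ 1) :+ n) :* u :- (s :+ f)) refl (fromℕ n) u (∑ n f) (f n))

  ∑-≥ : ∀ n {f u} → (∀ i → u ≤ f i) → fromℕ n * u ≤ ∑ n f
  ∑-≥ zero    {u = u} h = ≤-reflexive (zeroˡ u)
  ∑-≥ (suc n) {f} {u} h = ≤-by (∑-≥ n h ⊕ h n)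
    (solve 4 (λ n u s f → s :+ f :- (n :* u :+ u) := s :+ f :- (con (+ 1) :+ n) :* u) refl (fromℕ n) u (∑ n f) (f n))

  ∑-double : ∀ n f → ∑ (n ℕ.+ n) f ≈ ∑ n (λ i → f (i ℕ.+ i) + f (suc (i ℕ.+ i)))
  ∑-double zero    f = refl
  ∑-double (suc n) f rewrite ℕ.+-suc n n =
    trans (+-assoc _ _ _) (+-congʳ (∑-double n f))

  ∑-agree : ∀ n {i f g} → n ℕ.≤ i → (∀ j → j ≢ i → g j ≈ f j) → ∑ n g ≈ ∑ n f
  ∑-agree n n≤i h = ∑-cong n λ j j<n → h j λ { ≡.refl → ℕ.<⇒≱ j<n n≤i }

  -- This trades the condition m ≠ n for the subtraction of a diagonal term.
  ∑-omit : ∀ n {i f g} → i ℕ.< n → g i ≈ 0# → (∀ j → j ≢ i → g j ≈ f j) → ∑ n g ≈ ∑ n f - f i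
  ∑-omit (suc n) {i} {f} {g} (ℕ.s≤s i≤n) gi≈0 h with ℕ.m≤n⇒m<n∨m≡n i≤n
  ... | inj₁ i<n = begin
    ∑ n g + g n          ≈⟨ +-cong (∑-omit n i<n gi≈0 h) (h n (≡.≢-sym (ℕ.<⇒≢ i<n))) ⟩
    ∑ n f - f i + f n    ≈⟨ solve 3 (λ s a b → s :- a :+ b := s :+ b :- a) refl (∑ n f) (f i) (f n) ⟩
    ∑ n f + f n - f i    ∎
  ... | inj₂ ≡.refl = begin
    ∑ n g + g n          ≈⟨ +-cong (∑-agree n ℕ.≤-refl h) gi≈0 ⟩
    ∑ n f + 0#           ≈⟨ solve 2 (λ s a → s :+ con (+ 0) := s :+ a :- a) refl (∑ n f) (f n) ⟩
    ∑ n f + f n - f n    ∎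

  -- The van der Corput sequence

  fromℕ-2^suc : ∀ k → fromℕ (2 ℕ.^ suc k) ≈ fromℕ (2 ℕ.^ k) + fromℕ (2 ℕ.^ k)
  fromℕ-2^suc k = trans (fromℕ-+ (2 ℕ.^ k) (2 ℕ.^ k ℕ.+ 0))
    (+-congˡ (trans (fromℕ-+ (2 ℕ.^ k) 0) (+-identityʳ _)))

  lastDigit : ℕ → Carrier
  lastDigit 0             = 0#
  lastDigit 1             = ½
  lastDigit (suc (suc n)) = lastDigit n

  lastDigit-even : ∀ n → lastDigit (n ℕ.+ n) ≈ 0#
  lastDigit-even zero    = refl
  lastDigit-even (suc n) rewrite ℕ.+-suc n n = lastDigit-even n

  lastDigit-odd : ∀ n → lastDigit (suc (n ℕ.+ n)) ≈ ½
  lastDigit-odd zero    = refl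
  lastDigit-odd (suc n) rewrite ℕ.+-suc n n = lastDigit-odd n

  0≤lastDigit : ∀ n → 0# ≤ lastDigit n
  0≤lastDigit 0             = ≤-refl
  0≤lastDigit 1             = <⇒≤ 0<½
  0≤lastDigit (suc (suc n)) = 0≤lastDigit n

  lastDigit≤½ : ∀ n → lastDigit n ≤ ½
  lastDigit≤½ 0             = <⇒≤ 0<½
  lastDigit≤½ 1             = ≤-refl
  lastDigit≤½ (suc (suc n)) = lastDigit≤½ n

  reflectDigits : ℕ → ℕ → Carrier
  reflectDigits zero    n = 0#
  reflectDigits (suc k) n = lastDigit n + ½ * reflectDigits k ⌊ n /2⌋

  -- Reflecting n digits is enough, since n < 2 ^ n.
  vdc : ℕ → Carrier
  vdc n = reflectDigits n n

  reflectDigits-bounds : ∀ k n → 0# ≤ reflectDigits k n × reflectDigits k n < 1#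
  reflectDigits-bounds zero    n = ≤-refl , 0<1
  reflectDigits-bounds (suc k) n =
    let 0≤v , v<1 = reflectDigits-bounds k ⌊ n /2⌋
        v = reflectDigits k ⌊ n /2⌋
    in ≤-by (0≤lastDigit n ⊕ *-nonNegative (<⇒≤ 0<½) 0≤v)
         (solve 1 (λ x → x :- (con (+ 0) :+ con (+ 0)) := x :- con (+ 0)) refl (lastDigit n + ½ * v))
     , <-by (lastDigit≤½ n ⊕< *-monoˡ-< 0<½ v<1 <⊕ ≤-reflexive ½+½)
         (solve 3 (λ d h v → h :+ (h :* con (+ 1) :+ con (+ 1)) :- (d :+ (h :* v :+ (h :+ h))) := con (+ 1) :- (d :+ h :* v))
           refl (lastDigit n) ½ v)

  reflectDigits-zero : ∀ k → reflectDigits k 0 ≈ 0#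
  reflectDigits-zero zero    = refl
  reflectDigits-zero (suc k) = begin
    0# + ½ * reflectDigits k 0   ≈⟨ +-congˡ (*-congˡ (reflectDigits-zero k)) ⟩
    0# + ½ * 0#                  ≈⟨ solve 1 (λ h → con (+ 0) :+ h :* con (+ 0) := con (+ 0)) refl ½ ⟩
    0#                           ∎

  half-≤ : ∀ {k} n → n ℕ.≤ suc k → ⌊ n /2⌋ ℕ.≤ k
  half-≤ zero    _ = ℕ.z≤n
  half-≤ (suc n) h = ℕ.≤-pred (ℕ.≤-trans (ℕ.⌊n/2⌋<n n) h)

  -- The number of digits read is fuel for structural recursion. Surplus digits are zeros, so
  -- `vdc-even` and `vdc-odd` may discard the fuel left over after halving the index.
  reflectDigits-stable : ∀ k l {n} → n ℕ.≤ k → n ℕ.≤ l → reflectDigits k n ≈ reflectDigits l n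
  reflectDigits-stable zero    l       ℕ.z≤n _     = sym (reflectDigits-zero l)
  reflectDigits-stable (suc k) zero    _     ℕ.z≤n = reflectDigits-zero (suc k)
  reflectDigits-stable (suc k) (suc l) {n} p q     =
    +-congˡ (*-congˡ (reflectDigits-stable k l (half-≤ n p) (half-≤ n q)))

  vdc-even : ∀ n → vdc (n ℕ.+ n) ≈ ½ * vdc n
  vdc-even n = begin
    vdc (n ℕ.+ n)
      ≈⟨ reflectDigits-stable (n ℕ.+ n) (suc (n ℕ.+ n)) ℕ.≤-refl (ℕ.n≤1+n _) ⟩
    lastDigit (n ℕ.+ n) + ½ * reflectDigits (n ℕ.+ n) ⌊ n ℕ.+ n /2⌋
      ≡⟨ ≡.cong (λ m → lastDigit (n ℕ.+ n) + ½ * reflectDigits (n ℕ.+ n) m) (ℕ.n≡⌊n+n/2⌋ n) ⟨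
    lastDigit (n ℕ.+ n) + ½ * reflectDigits (n ℕ.+ n) n
      ≈⟨ +-cong (lastDigit-even n) (*-congˡ (reflectDigits-stable (n ℕ.+ n) n (ℕ.m≤m+n n n) ℕ.≤-refl)) ⟩
    0# + ½ * vdc n
      ≈⟨ +-identityˡ _ ⟩
    ½ * vdc n ∎

  vdc-odd : ∀ n → vdc (suc (n ℕ.+ n)) ≈ ½ + ½ * vdc n
  vdc-odd n = begin
    lastDigit (suc (n ℕ.+ n)) + ½ * reflectDigits (n ℕ.+ n) ⌊ suc (n ℕ.+ n) /2⌋
      ≡⟨ ≡.cong (λ m → lastDigit (suc (n ℕ.+ n)) + ½ * reflectDigits (n ℕ.+ n) m) (ℕ.n≡⌈n+n/2⌉ n) ⟨
    lastDigit (suc (n ℕ.+ n)) + ½ * reflectDigits (n ℕ.+ n) n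
      ≈⟨ +-cong (lastDigit-odd n) (*-congˡ (reflectDigits-stable (n ℕ.+ n) n (ℕ.m≤m+n n n) ℕ.≤-refl)) ⟩
    ½ + ½ * vdc n ∎

  ½*-double : ∀ x → ½ * x + ½ * x ≈ x
  ½*-double x = begin
    ½ * x + ½ * x     ≈⟨ distribʳ x ½ ½ ⟨
    (½ + ½) * x       ≈⟨ *-congʳ ½+½ ⟩
    1# * x            ≈⟨ *-identityˡ x ⟩
    x                 ∎

  -- An index below `2 ^ k` has at most `k` binary digits, so its reflection is a fraction with
  -- denominator `2 ^ k`.
  2^k*vdc-integer : ∀ k i → i ℕ.< 2 ℕ.^ k → IsInteger (fromℕ (2 ℕ.^ k) * vdc i)
  2^k*vdc-integer zero zero h = + 0 , zeroʳ _
  2^k*vdc-integer zero (suc i) (ℕ.s≤s ())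
  2^k*vdc-integer (suc k) i h with halve i
  ... | m , inj₁ ≡.refl = IsInteger-resp-≈ (sym (begin
      fromℕ (2 ℕ.^ suc k) * vdc (m ℕ.+ m)   ≈⟨ *-cong (fromℕ-2^suc k) (vdc-even m) ⟩
      (p + p) * (½ * vdc m)                 ≈⟨ solve 3 (λ p h v → (p :+ p) :* (h :* v) := p :* (h :* v :+ h :* v)) refl p ½ (vdc m) ⟩
      p * (½ * vdc m + ½ * vdc m)           ≈⟨ *-congˡ (½*-double (vdc m)) ⟩
      p * vdc m                             ∎))
      (2^k*vdc-integer k m (half-<-2^ k h))
    where p = fromℕ (2 ℕ.^ k)
  ... | m , inj₂ ≡.refl = IsInteger-resp-≈ (sym (begin
      fromℕ (2 ℕ.^ suc k) * vdc (suc (m ℕ.+ m))   ≈⟨ *-cong (fromℕ-2^suc k) (vdc-odd m) ⟩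
      (p + p) * (½ + ½ * vdc m)                   ≈⟨ solve 3 (λ p h v → (p :+ p) :* (h :+ h :* v) := p :* (h :+ h :+ (h :* v :+ h :* v))) refl p ½ (vdc m) ⟩
      p * (½ + ½ + (½ * vdc m + ½ * vdc m))       ≈⟨ *-congˡ (+-cong ½+½ (½*-double (vdc m))) ⟩
      p * (1# + vdc m)                            ≈⟨ solve 2 (λ p v → p :* (con (+ 1) :+ v) := p :+ p :* v) refl p (vdc m) ⟩
      p + p * vdc m                               ∎))
      (IsInteger-+ (IsInteger-fromℕ (2 ℕ.^ k)) (2^k*vdc-integer k m (half-<-2^ k (ℕ.≤-trans (ℕ.n≤1+n _) h))))
    where p = fromℕ (2 ℕ.^ k)

  -- Distribution of the first terms

  -- The number of i < n, with multiplicity, for which an integer lies within r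
  -- of vdc i + c.
  hits : ℕ → Carrier → Carrier → Carrier
  hits n c r = ∑ n λ i → integersNear (vdc i + c) r

  -- The terms with indices 2 i and 2 i + 1 are the two preimages of `vdc i` under doubling modulo
  -- 1, so each such pair falls under `integersNear-double`.
  hits-double : ∀ n c r → hits (n ℕ.+ n) c r ≈ hits n (c + c) (r + r)
  hits-double n c r = trans (∑-double n _) (∑-cong n λ i _ → begin
    integersNear (vdc (i ℕ.+ i) + c) r + integersNear (vdc (suc (i ℕ.+ i)) + c) r
      ≈⟨ +-cong (integersNear-cong (+-congʳ (vdc-even i)) refl)
                (integersNear-cong (trans (+-congʳ (vdc-odd i))
                  (solve 3 (λ h w c → h :+ w :+ c := w :+ c :+ h) refl ½ (½ * vdc i) c)) refl) ⟩
    integersNear (½ * vdc i + c) r + integersNear (½ * vdc i + c + ½) r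
      ≈⟨ integersNear-double (½ * vdc i + c) r ⟩
    integersNear (½ * vdc i + c + (½ * vdc i + c)) (r + r)
      ≈⟨ integersNear-cong (trans
           (solve 2 (λ w c → w :+ c :+ (w :+ c) := w :+ w :+ (c :+ c)) refl (½ * vdc i) c)
           (+-congʳ (½*-double (vdc i)))) refl ⟩
    integersNear (vdc i + (c + c)) (r + r) ∎)

  -- After `k` doublings a single term is left, `vdc 0`, which is 0.
  hits-2^ : ∀ k c r → hits (2 ℕ.^ k) c r ≈ integersNear (fromℕ (2 ℕ.^ k) * c) (fromℕ (2 ℕ.^ k) * r)
  hits-2^ zero c r = begin
    0# + integersNear (0# + c) r           ≈⟨ +-identityˡ _ ⟩
    integersNear (0# + c) r                ≈⟨ integersNear-cong (1* c (+-identityˡ c)) (1* r refl) ⟩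
    integersNear (fromℕ 1 * c) (fromℕ 1 * r) ∎
    where
    1* : ∀ x {y} → y ≈ x → y ≈ fromℕ 1 * x
    1* x e = trans e (sym (trans (*-congʳ fromℕ-1) (*-identityˡ x)))
  hits-2^ (suc k) c r = begin
    hits (2 ℕ.^ suc k) c r
      ≡⟨ ≡.cong (λ m → hits (2 ℕ.^ k ℕ.+ m) c r) (ℕ.+-identityʳ (2 ℕ.^ k)) ⟩
    hits (2 ℕ.^ k ℕ.+ 2 ℕ.^ k) c r
      ≈⟨ hits-double (2 ℕ.^ k) c r ⟩
    hits (2 ℕ.^ k) (c + c) (r + r)
      ≈⟨ hits-2^ k (c + c) (r + r) ⟩
    integersNear (p * (c + c)) (p * (r + r))
      ≈⟨ integersNear-cong (double c) (double r) ⟩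
    integersNear (fromℕ (2 ℕ.^ suc k) * c) (fromℕ (2 ℕ.^ suc k) * r) ∎
    where
    p = fromℕ (2 ℕ.^ k)
    double : ∀ x → p * (x + x) ≈ fromℕ (2 ℕ.^ suc k) * x
    double x = trans (solve 2 (λ p x → p :* (x :+ x) := (p :+ p) :* x) refl p x) (*-congʳ (sym (fromℕ-2^suc k)))

  -- Each binary digit of `n` costs at most 1. An even number is halved without loss; an odd one has
  -- an unpaired last term, whose count differs from `r + r` by at most 1. No bound on `r` is
  -- imposed, because `r` doubles along the induction.
  hits-bounds : ∀ k n → n ℕ.< 2 ℕ.^ k → ∀ c r →
    fromℕ n * (r + r) - fromℕ k ≤ hits n c r × hits n c r ≤ fromℕ n * (r + r) + fromℕ k
  hits-bounds zero zero    _ c r =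
    ≤-reflexive (solve 1 (λ x → con (+ 0) :* x :- con (+ 0) := con (+ 0)) refl (r + r)) ,
    ≤-reflexive (solve 1 (λ x → con (+ 0) := con (+ 0) :* x :+ con (+ 0)) refl (r + r))
  hits-bounds zero (suc n) (ℕ.s≤s ()) c r
  hits-bounds (suc k) n h c r with halve n
  ... | m , inj₁ ≡.refl =
    let lower , upper = hits-bounds k m (half-<-2^ k h) (c + c) (r + r)
        hits≈ = sym (hits-double m c r)
    in ≤-trans (≤-by 0≤1 (lower-eq m)) (≤-cong refl hits≈ lower)
     , ≤-trans (≤-cong hits≈ refl upper) (≤-by 0≤1 (upper-eq m))
    where
    lower-eq : ∀ m → 1# - 0# ≈ (fromℕ m * (r + r + (r + r)) - fromℕ k) - (fromℕ (m ℕ.+ m) * (r + r) - fromℕ (suc k))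
    lower-eq m = trans
      (solve 3 (λ m r k → con (+ 1) :- con (+ 0)
        := (m :* (r :+ r :+ (r :+ r)) :- k) :- ((m :+ m) :* (r :+ r) :- (con (+ 1) :+ k))) refl (fromℕ m) r (fromℕ k))
      (+-congˡ (-‿cong (+-congʳ (*-congʳ (sym (fromℕ-+ m m))))))
    upper-eq : ∀ m → 1# - 0# ≈ (fromℕ (m ℕ.+ m) * (r + r) + fromℕ (suc k)) - (fromℕ m * (r + r + (r + r)) + fromℕ k)
    upper-eq m = trans
      (solve 3 (λ m r k → con (+ 1) :- con (+ 0)
        := ((m :+ m) :* (r :+ r) :+ (con (+ 1) :+ k)) :- (m :* (r :+ r :+ (r :+ r)) :+ k)) refl (fromℕ m) r (fromℕ k))
      (+-congʳ (+-congʳ (*-congʳ (sym (fromℕ-+ m m)))))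
  ... | m , inj₂ ≡.refl =
    let lower , upper = hits-bounds k m (half-<-2^ k (ℕ.≤-trans (ℕ.n≤1+n _) h)) (c + c) (r + r)
        hits≈ = sym (hits-double m c r)
        y = vdc (m ℕ.+ m) + c
    in ≤-by (≤-cong refl hits≈ lower ⊕ <⇒≤ (<-integersNear y r)) (trans
         (solve 5 (λ m r k s i → s :+ i :- (m :* (r :+ r :+ (r :+ r)) :- k :+ (r :+ r :- con (+ 1)))
           := s :+ i :- ((con (+ 1) :+ (m :+ m)) :* (r :+ r) :- (con (+ 1) :+ k)))
           refl (fromℕ m) r (fromℕ k) (hits (m ℕ.+ m) c r) (integersNear y r))
         (+-congˡ (-‿cong (+-congʳ (*-congʳ (+-congˡ (sym (fromℕ-+ m m))))))))
     , ≤-by (≤-cong hits≈ refl upper ⊕ integersNear-≤ y r) (trans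
         (solve 5 (λ m r k s i → (m :* (r :+ r :+ (r :+ r)) :+ k :+ (r :+ r :+ con (+ 1))) :- (s :+ i)
           := (con (+ 1) :+ (m :+ m)) :* (r :+ r) :+ (con (+ 1) :+ k) :- (s :+ i))
           refl (fromℕ m) r (fromℕ k) (hits (m ℕ.+ m) c r) (integersNear y r))
         (+-congʳ (+-congʳ (*-congʳ (+-congˡ (sym (fromℕ-+ m m)))))))

  -- From lengths of filtered lists to sums

  listSum : {A : Set} → (A → Carrier) → List A → Carrier
  listSum f []       = 0#
  listSum f (x ∷ xs) = f x + listSum f xs

  listSum-++ : ∀ {A} (f : A → Carrier) xs ys → listSum f (xs ++ ys) ≈ listSum f xs + listSum f ys
  listSum-++ f []       ys = sym (+-identityˡ _)
  listSum-++ f (x ∷ xs) ys = trans (+-congˡ (listSum-++ f xs ys)) (sym (+-assoc _ _ _))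

  listSum-map : ∀ {A B} (f : B → Carrier) (g : A → B) xs → listSum f (map g xs) ≈ listSum (f ∘ g) xs
  listSum-map f g []       = refl
  listSum-map f g (x ∷ xs) = +-congˡ (listSum-map f g xs)

  listSum-cartesianProduct : ∀ {A B} (f : A × B → Carrier) xs ys →
    listSum f (cartesianProduct xs ys) ≈ listSum (λ x → listSum (λ y → f (x , y)) ys) xs
  listSum-cartesianProduct f []       ys = refl
  listSum-cartesianProduct f (x ∷ xs) ys =
    trans (listSum-++ f (map (x ,_) ys) (cartesianProduct xs ys))
          (+-cong (listSum-map f (x ,_) ys) (listSum-cartesianProduct f xs ys))

  listSum-upTo : ∀ f n → listSum f (upTo n) ≈ ∑ n f
  listSum-upTo f zero    = refl
  listSum-upTo f (suc n) = begin
    listSum f (upTo (suc n))                   ≡⟨ ≡.cong (listSum f) (upTo-∷ʳ n) ⟨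
    listSum f (upTo n ++ n ∷ [])               ≈⟨ listSum-++ f (upTo n) (n ∷ []) ⟩
    listSum f (upTo n) + (f n + 0#)            ≈⟨ +-cong (listSum-upTo f n) (+-identityʳ _) ⟩
    ∑ n f + f n                                ∎

  listSum-indices : ∀ f n → listSum f (map suc (upTo n)) ≈ ∑ n (f ∘ suc)
  listSum-indices f n = trans (listSum-map f suc (upTo n)) (listSum-upTo (f ∘ suc) n)

  fromℕ-length-filter : ∀ {A} {P : Pred A 0ℓ} (P? : Decidable P) xs →
    fromℕ (length (filter P? xs)) ≈ listSum (indicator ∘ P?) xs
  fromℕ-length-filter P? []       = refl
  fromℕ-length-filter P? (x ∷ xs) with does (P? x)
  ... | true  = +-congˡ (fromℕ-length-filter P? xs)
  ... | false = trans (fromℕ-length-filter P? xs) (sym (+-identityˡ _))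

  pairCount≈∑ : ∀ x γ r n → fromℕ (pairCount x γ r n) ≈
    ∑ n λ i → ∑ n λ j →
      indicator (¬? (suc i ℕ.≟ suc j) ×-dec (‖ x (suc i) - x (suc j) - γ ‖ ≤? r))
  pairCount≈∑ x γ r n =
    trans (fromℕ-length-filter _ (cartesianProduct indices indices))
    (trans (listSum-cartesianProduct _ indices indices)
    (trans (listSum-indices _ n)
    (∑-cong n λ i _ → listSum-indices _ n)))
    where indices = map suc (upTo n)

  indicator-× : ∀ {P Q : Set} (p? : Dec P) (q? : Dec Q) → ¬ P → indicator (¬? p? ×-dec q?) ≈ indicator q?
  indicator-× (yes p) q? ¬p = contradiction p ¬p
  indicator-× (no _)  q? ¬p = refl

  indicator-×-0 : ∀ {P Q : Set} (p? : Dec P) (q? : Dec Q) → P → indicator (¬? p? ×-dec q?) ≈ 0#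
  indicator-×-0 (yes _) q? p = refl
  indicator-×-0 (no ¬p) q? p = contradiction p ¬p

  0≤indicator : ∀ {P : Set} (p? : Dec P) → 0# ≤ indicator p?
  0≤indicator (yes _) = 0≤1
  0≤indicator (no _)  = ≤-refl

  indicator≤1 : ∀ {P : Set} (p? : Dec P) → indicator p? ≤ 1#
  indicator≤1 (yes _) = ≤-refl
  indicator≤1 (no _)  = 0≤1

  -- Pair counts of the sequence

  -- Terms are numbered from 1 but the digit recursion starts at 0; with the shift, the first `n`
  -- terms are exactly `vdc i` for `i < n`.
  vdcSequence : ℕ → Carrier
  vdcSequence n = vdc (pred n)

  module _ (γ : Carrier) {r : Carrier} (0≤r : 0# ≤ r) (r<½ : r < ½) where

    -- For fixed `i`, the difference `vdc i - vdc j - γ` is the negative of `vdc j + (γ - vdc i)`,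
    -- and the count is even in its centre. The omitted term `j = i` has centre `γ`, whatever `i`
    -- is.
    pairCount≈hits : ∀ n → fromℕ (pairCount vdcSequence γ r n) ≈
      ∑ n λ i → hits n (γ - vdc i) r - integersNear γ r
    pairCount≈hits n = trans (pairCount≈∑ vdcSequence γ r n) (∑-cong n λ i i<n →
      trans (∑-omit n i<n
              (indicator-×-0 (suc i ℕ.≟ suc i) (‖ vdc i - vdc i - γ ‖ ≤? r) ≡.refl)
              (λ j j≢i → trans
                (indicator-× (suc i ℕ.≟ suc j) (‖ vdc i - vdc j - γ ‖ ≤? r)
                  (λ e → j≢i (≡.sym (ℕ.suc-injective e))))
                (trans (sym (integersNear≈indicator 0≤r r<½ (vdc i - vdc j - γ)))
                (trans (integersNear-cong
                          (solve 3 (λ x y g → x :- y :- g := :- (y :+ (g :- x))) refl (vdc i) (vdc j) γ) refl)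
                       (integersNear-neg (vdc j + (γ - vdc i)) r)))))
        (+-congˡ (-‿cong (integersNear-cong (solve 2 (λ x g → x :+ (g :- x) := g) refl (vdc i) γ) refl))))

    -- Each row errs by at most `k`, and by at most 1 more for the diagonal term, which is 0 or 1.
    pairCount-bounds : ∀ k n → n ℕ.< 2 ℕ.^ k →
      fromℕ n * (fromℕ n * (r + r)) - fromℕ n * fromℕ (suc k) ≤ fromℕ (pairCount vdcSequence γ r n) ×
      fromℕ (pairCount vdcSequence γ r n) ≤ fromℕ n * (fromℕ n * (r + r)) + fromℕ n * fromℕ (suc k)
    pairCount-bounds k n n<2^k =
        ≤-cong (solve 3 (λ n x k → n :* (x :- k) := n :* x :- n :* k) refl (fromℕ n) (fromℕ n * (r + r)) (fromℕ (suc k)))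
          (sym (pairCount≈hits n))
          (∑-≥ n λ i → ≤-by (proj₁ (hits-bounds k n n<2^k (γ - vdc i) r) ⊕ d≤1)
            (solve 4 (λ x k s d → s :+ con (+ 1) :- (x :- k :+ d) := s :- d :- (x :- (con (+ 1) :+ k))) refl
              (fromℕ n * (r + r)) (fromℕ k) (hits n (γ - vdc i) r) d))
      , ≤-cong (sym (pairCount≈hits n))
          (solve 3 (λ n x k → n :* (x :+ k) := n :* x :+ n :* k) refl (fromℕ n) (fromℕ n * (r + r)) (fromℕ (suc k)))
          (∑-≤ n λ i → ≤-by (proj₂ (hits-bounds k n n<2^k (γ - vdc i) r) ⊕ 0≤d ⊕ 0≤1)
            (solve 4 (λ x k s d → x :+ k :+ (d :+ con (+ 1)) :- (s :+ (con (+ 0) :+ con (+ 0))) := x :+ (con (+ 1) :+ k) :- (s :- d)) refl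
              (fromℕ n * (r + r)) (fromℕ k) (hits n (γ - vdc i) r) d))
      where
      d = integersNear γ r
      d≈ = sym (integersNear≈indicator 0≤r r<½ γ)
      0≤d : 0# ≤ d
      0≤d = ≤-cong refl d≈ (0≤indicator (‖ γ ‖ ≤? r))
      d≤1 : d ≤ 1#
      d≤1 = ≤-cong d≈ refl (indicator≤1 (‖ γ ‖ ≤? r))

    -- After scaling by `2 ^ k`, the centres of the rows differ by integers, so all rows contribute
    -- the same integer.
    pairCount-2^ : ∀ k → ∃[ z ] IsInteger z × fromℕ (pairCount vdcSequence γ r (2 ℕ.^ k)) ≈ fromℕ (2 ℕ.^ k) * z
    pairCount-2^ k =
        integersNear (p * γ) (p * r) - integersNear γ r
      , IsInteger-- (integersNear-integer (p * γ) (p * r)) (integersNear-integer γ r)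
      , trans (pairCount≈hits (2 ℕ.^ k)) (∑-const (2 ℕ.^ k) λ i i<2^k → +-congʳ (begin
          hits (2 ℕ.^ k) (γ - vdc i) r
            ≈⟨ hits-2^ k (γ - vdc i) r ⟩
          integersNear (p * (γ - vdc i)) (p * r)
            ≈⟨ integersNear-cong (solve 3 (λ p g v → p :* (g :- v) := p :* g :+ :- (p :* v)) refl p γ (vdc i)) refl ⟩
          integersNear (p * γ + - (p * vdc i)) (p * r)
            ≈⟨ integersNear-shift (p * γ) (p * r) (IsInteger-neg (2^k*vdc-integer k i i<2^k)) ⟩
          integersNear (p * γ) (p * r) ∎))
      where p = fromℕ (2 ℕ.^ k)

  vdcSequence-InUnitInterval : InUnitInterval vdcSequence
  vdcSequence-InUnitInterval n = reflectDigits-bounds (pred n) (pred n)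

  -- Failure of γ-PPC

  ¬vdcSequence-HasPPC : ∀ γ → ¬ HasPPC γ vdcSequence
  ¬vdcSequence-HasPPC γ ppc = ≉0 0<z (IsInteger-discrete z-integer (<-trans -1<0 0<z) z<1)
    where
    ¼ : Carrier
    ¼ = ½ * ½
    0<¼ : 0# < ¼
    0<¼ = *-pos 0<½ 0<½
    -1<0 : - 1# < 0#
    -1<0 = <-by 0<1 (solve 0 (con (+ 1) :- con (+ 0) := con (+ 0) :- (:- con (+ 1))) refl)
    4¼ : ¼ + ¼ + (¼ + ¼) ≈ 1#
    4¼ = trans (+-cong (½*-double ½) (½*-double ½)) ½+½
    -- The first `¼` is s, making the limit 1/2; the second is the tolerance, which confines the
    -- average strictly between 0 and 1, where no integer lies.
    limit = ppc ¼ 0<¼ ¼ 0<¼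
    k = proj₁ limit
    -- The threshold itself serves as exponent: `k < 2 ^ k` puts `n` beyond it.
    n = 2 ℕ.^ k
    0<n : 0# < fromℕ n
    0<n = 0<fromℕ (ℕ.≤-trans (ℕ.s≤s ℕ.z≤n) (n<2^n k))
    r = ¼ / fromℕ n
    0≤r : 0# ≤ r
    0≤r = <⇒≤ (*-pos 0<¼ (⁻¹-pos 0<n))
    n⁻¹≤1 : fromℕ n ⁻¹ ≤ 1#
    n⁻¹≤1 = ≤-cong (*-identityʳ _) (⁻¹-inverseˡ 0<n)
      (*-monoˡ-≤ (<⇒≤ (⁻¹-pos 0<n)) (1≤fromℕ (ℕ.≤-trans (ℕ.s≤s ℕ.z≤n) (n<2^n k))))
    r<½ : r < ½
    r<½ = ≤-<-trans (*-monoˡ-≤ (<⇒≤ 0<¼) n⁻¹≤1)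
      (<-by 0<¼ (trans (solve 1 (λ q → q :- con (+ 0) := q :+ q :- q :* con (+ 1)) refl ¼) (+-congʳ (½*-double ½))))
    count = pairCount-2^ γ 0≤r r<½ k
    z = proj₁ count
    z-integer = proj₁ (proj₂ count)
    average≈z : 1# / fromℕ n * fromℕ (pairCount vdcSequence γ r n) ≈ z
    average≈z = begin
      1# / fromℕ n * fromℕ (pairCount vdcSequence γ r n)
        ≈⟨ *-congˡ (proj₂ (proj₂ count)) ⟩
      1# / fromℕ n * (fromℕ n * z)
        ≈⟨ solve 3 (λ i n z → con (+ 1) :* i :* (n :* z) := i :* n :* z) refl (fromℕ n ⁻¹) (fromℕ n) z ⟩
      fromℕ n ⁻¹ * fromℕ n * z
        ≈⟨ *-congʳ (⁻¹-inverseˡ 0<n) ⟩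
      1# * z
        ≈⟨ *-identityˡ z ⟩
      z ∎
    error<¼ = proj₂ limit n (ℕ.<⇒≤ (n<2^n k))
    difference≈ : 1# / fromℕ n * fromℕ (pairCount vdcSequence γ r n) - fromℕ 2 * ¼ ≈ z - (¼ + ¼)
    difference≈ = +-cong average≈z (solve 1 (λ q → :- (con (+ 2) :* q) := :- (q :+ q)) refl ¼)
    z-½<¼ : z - (¼ + ¼) < ¼
    z-½<¼ = <-cong difference≈ refl (≤-<-trans (x≤∣x∣ _) error<¼)
    ½-z<¼ : - (z - (¼ + ¼)) < ¼
    ½-z<¼ = <-cong (-‿cong difference≈) refl (≤-<-trans (-x≤∣x∣ _) error<¼)
    0<z : 0# < z
    0<z = <-by (½-z<¼ <⊕ <⇒≤ 0<¼) (solve 2 (λ z q → q :+ q :- (:- (z :- (q :+ q)) :+ con (+ 0)) := z :- con (+ 0)) refl z ¼)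
    z<1 : z < 1#
    z<1 = <-by (z-½<¼ <⊕ <⇒≤ 0<¼ ⊕ ≤-reflexive 4¼)
      (solve 2 (λ z q → q :+ (q :+ con (+ 1)) :- (z :- (q :+ q) :+ (con (+ 0) :+ (q :+ q :+ (q :+ q)))) := con (+ 1) :- z) refl z ¼)

  -- Powers, roots and real powers

  open import Algebra.Properties.Semiring.Exp semiring using (^-homo-*; ^-assocʳ; ^-congˡ; ^-congʳ)
  open import Algebra.Properties.CommutativeSemiring.Exp commutativeSemiring using (^-distrib-*)

  ^-nonNegative : ∀ {x} n → 0# ≤ x → 0# ≤ x ^ n
  ^-nonNegative zero    0≤x = 0≤1
  ^-nonNegative (suc n) 0≤x = *-nonNegative 0≤x (^-nonNegative n 0≤x)

  ^-pos : ∀ {x} n → 0# < x → 0# < x ^ n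
  ^-pos zero    0<x = 0<1
  ^-pos (suc n) 0<x = *-pos 0<x (^-pos n 0<x)

  ^-mono-≤ : ∀ {x y} n → 0# ≤ x → x ≤ y → x ^ n ≤ y ^ n
  ^-mono-≤ zero    0≤x x≤y = ≤-refl
  ^-mono-≤ (suc n) 0≤x x≤y = *-mono-≤ 0≤x x≤y (^-nonNegative n 0≤x) (^-mono-≤ n 0≤x x≤y)

  ^-mono-< : ∀ {x y} n → 0# ≤ x → x < y → x ^ suc n < y ^ suc n
  ^-mono-< {x} {y} n 0≤x x<y = ≤-<-trans
    (*-monoˡ-≤ 0≤x (^-mono-≤ n 0≤x (<⇒≤ x<y)))
    (<-cong (*-comm _ _) (*-comm _ _) (*-monoˡ-< (^-pos n (≤-<-trans 0≤x x<y)) x<y))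

  ^-cancel-≤ : ∀ {x y} n → 0# ≤ y → x ^ suc n ≤ y ^ suc n → x ≤ y
  ^-cancel-≤ {x} {y} n 0≤y h with x ≤? y
  ... | yes x≤y = x≤y
  ... | no  x≰y = contradiction h (<⇒≱ (^-mono-< n 0≤y (≰⇒> x≰y)))

  1≤^ : ∀ {b} n → 1# ≤ b → 1# ≤ b ^ n
  1≤^ zero    1≤b = ≤-refl
  1≤^ (suc n) 1≤b = ≤-cong (*-identityˡ 1#) refl (*-mono-≤ 0≤1 1≤b 0≤1 (1≤^ n 1≤b))

  ^-monoʳ-≤ : ∀ {b m n} → 1# ≤ b → m ℕ.≤ n → b ^ m ≤ b ^ n
  ^-monoʳ-≤ {n = n} 1≤b ℕ.z≤n = 1≤^ n 1≤b
  ^-monoʳ-≤ 1≤b (ℕ.s≤s h)     = *-monoˡ-≤ (≤-trans 0≤1 1≤b) (^-monoʳ-≤ 1≤b h)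

  fromℕ-^ : ∀ m n → fromℕ (m ℕ.^ n) ≈ fromℕ m ^ n
  fromℕ-^ m zero    = fromℕ-1
  fromℕ-^ m (suc n) = trans (fromℕ-* m (m ℕ.^ n)) (*-congˡ (fromℕ-^ m n))

  bernoulli : ∀ {h} n → 0# ≤ h → 1# + fromℕ n * h ≤ (1# + h) ^ n
  bernoulli {h} zero    0≤h = ≤-reflexive (solve 1 (λ h → con (+ 1) :+ con (+ 0) :* h := con (+ 1)) refl h)
  bernoulli {h} (suc n) 0≤h = ≤-trans
    (≤-by (*-nonNegative (0≤fromℕ n) (*-nonNegative 0≤h 0≤h))
      (solve 2 (λ n h → n :* (h :* h) :- con (+ 0)
        := (con (+ 1) :+ h) :* (con (+ 1) :+ n :* h) :- (con (+ 1) :+ (con (+ 1) :+ n) :* h)) refl (fromℕ n) h))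
    (*-monoˡ-≤ (≤-cong (+-identityʳ 0#) refl (0≤1 ⊕ 0≤h)) (bernoulli n 0≤h))

  /-*-cancel : ∀ x {y} → 0# < y → x / y * y ≈ x
  /-*-cancel x 0<y = trans (*-assoc _ _ _) (trans (*-congˡ (⁻¹-inverseˡ 0<y)) (*-identityʳ x))

  *-/-cancel : ∀ x {y} → 0# < y → y ⁻¹ * (x * y) ≈ x
  *-/-cancel x {y} 0<y = trans (solve 3 (λ i x y → i :* (x :* y) := x :* i :* y) refl (y ⁻¹) x y) (/-*-cancel x 0<y)

  ≤-/ : ∀ {x y z} → 0# < y → x * y ≤ z → x ≤ z / y
  ≤-/ {x} 0<y h = ≤-cong (*-/-cancel x 0<y) (*-comm _ _) (*-monoˡ-≤ (<⇒≤ (⁻¹-pos 0<y)) h)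

  <-/ : ∀ {x y z} → 0# < y → x * y < z → x < z / y
  <-/ {x} 0<y h = <-cong (*-/-cancel x 0<y) (*-comm _ _) (*-monoˡ-< (⁻¹-pos 0<y) h)

  /-≤ : ∀ {x y z} → 0# < y → x ≤ z / y → x * y ≤ z
  /-≤ {x} {y} {z} 0<y h = ≤-cong (*-comm _ _) (trans (*-comm _ _) (/-*-cancel z 0<y)) (*-monoˡ-≤ (<⇒≤ 0<y) h)

  /-< : ∀ {x y z} → 0# < y → x < z / y → x * y < z
  /-< {x} {y} {z} 0<y h = <-cong (*-comm _ _) (trans (*-comm _ _) (/-*-cancel z 0<y)) (*-monoˡ-< 0<y h)

  -- Powers of `B / w = 1 + h` grow past `b` by Bernoulli's inequality. This replaces taking n-th
  -- roots and letting n tend to infinity.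
  ¬^-bounded-ratio : ∀ {B w b} → 0# < w → w < B → ¬ (∀ n → B ^ suc n ≤ b * w ^ suc n)
  ¬^-bounded-ratio {B} {w} {b} 0<w w<B bounded =
    contradiction (≤-trans (bernoulli (suc n) (<⇒≤ 0<h)) u^n≤b) (<⇒≱ b<1+nh)
    where
    u = B / w
    h = u - 1#
    0<h : 0# < h
    0<h = 0<-diff (<-/ 0<w (<-cong (sym (*-identityˡ w)) refl w<B))
    n = proj₁ (archimedean (b / h))
    b<1+nh : b < 1# + fromℕ (suc n) * h
    b<1+nh = <-trans
      (<-cong (/-*-cancel b 0<h) refl
        (<-cong (*-comm _ _) (*-comm _ _) (*-monoˡ-< 0<h (proj₂ (archimedean (b / h))))))
      (<-by (0<1 <⊕ <⇒≤ 0<h)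
        (solve 2 (λ n h → con (+ 1) :+ h :- (con (+ 0) :+ con (+ 0)) := con (+ 1) :+ (con (+ 1) :+ n) :* h :- n :* h) refl (fromℕ n) h))
    u^n≤b : (1# + h) ^ suc n ≤ b
    u^n≤b = ≤-cong
      (begin
        (w ^ suc n) ⁻¹ * B ^ suc n            ≈⟨ *-congˡ (^-congˡ (suc n) (sym (/-*-cancel B 0<w))) ⟩
        (w ^ suc n) ⁻¹ * (u * w) ^ suc n      ≈⟨ *-congˡ (^-distrib-* u w (suc n)) ⟩
        (w ^ suc n) ⁻¹ * (u ^ suc n * w ^ suc n)  ≈⟨ *-/-cancel (u ^ suc n) (^-pos (suc n) 0<w) ⟩
        u ^ suc n                             ≈⟨ ^-congˡ (suc n) (solve 1 (λ u → u := con (+ 1) :+ (u :- con (+ 1))) refl u) ⟩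
        (1# + h) ^ suc n                      ∎)
      (*-/-cancel b (^-pos (suc n) 0<w))
      (*-monoˡ-≤ (<⇒≤ (⁻¹-pos (^-pos (suc n) 0<w))) (bounded n))

  RootsBelow : ℕ → Carrier → Pred Carrier 0ℓ
  RootsBelow q z t = 0# ≤ t × t ^ q ≤ z

  module _ (q : ℕ) {z : Carrier} (0≤z : 0# ≤ z) where

    -- `sup` says something only about bounded sets. A `t` above `1# + z` exceeds 1, so its powers
    -- are at least `t`, hence above `z`.
    RootsBelow-bounded : ∀ t → RootsBelow (suc q) z t → t ≤ 1# + z
    RootsBelow-bounded t (0≤t , t^q≤z) with t ≤? 1# + z
    ... | yes h = h
    ... | no  h = contradiction t^q≤z (<⇒≱ (<-trans (n<1+n z) (<-≤-trans 1+z<t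
      (≤-cong (*-identityʳ t) refl (*-monoˡ-≤ 0≤t (1≤^ q (≤-trans 1≤1+z (<⇒≤ 1+z<t))))))))
      where
      1+z<t = ≰⇒> h
      1≤1+z : 1# ≤ 1# + z
      1≤1+z = ≤-cong (+-identityʳ 1#) refl (+-monoʳ-≤ 1# 0≤z)

    ≤-root : ∀ {t} → 0# ≤ t → t ^ suc q ≤ z → t ≤ root (suc q) z
    ≤-root 0≤t h = sup-upper (RootsBelow (suc q) z) RootsBelow-bounded (0≤t , h)

    root-≤ : ∀ {u} → (∀ t → 0# ≤ t → t ^ suc q ≤ z → t ≤ u) → root (suc q) z ≤ u
    root-≤ h = sup-least (RootsBelow (suc q) z)
      (0# , ≤-refl , ≤-cong (sym (zeroˡ _)) refl 0≤z) (λ t (0≤t , t^q≤z) → h t 0≤t t^q≤z)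

  RationalPowers : Carrier → Carrier → Pred Carrier 0ℓ
  RationalPowers b a y = ∃[ p ] ∃[ q ] (fromℕ p ≤ a * fromℕ (suc q)) × (y ≈ root (suc q) (b ^ p))

  module _ {b : Carrier} (1≤b : 1# ≤ b) where

    private
      0≤b^ : ∀ p → 0# ≤ b ^ p
      0≤b^ p = ^-nonNegative p (≤-trans 0≤1 1≤b)

    RationalPowers-≤ : ∀ {a u} →
      (∀ p q t → fromℕ p ≤ a * fromℕ (suc q) → 0# ≤ t → t ^ suc q ≤ b ^ p → t ≤ u) →
      ∀ y → RationalPowers b a y → y ≤ u
    RationalPowers-≤ h y (p , q , p≤aq , y≈root) =
      ≤-cong (sym y≈root) refl (root-≤ q (0≤b^ p) λ t → h p q t p≤aq)

    rpow-≤ : ∀ {a u} → 0# ≤ a →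
      (∀ p q t → fromℕ p ≤ a * fromℕ (suc q) → 0# ≤ t → t ^ suc q ≤ b ^ p → t ≤ u) →
      rpow b a ≤ u
    rpow-≤ {a} 0≤a h = sup-least (RationalPowers b a)
      (_ , 0 , 0 , *-nonNegative 0≤a (0≤fromℕ 1) , refl) (RationalPowers-≤ h)

    -- The rational powers are bounded by `b ^ n` for a natural number `n` above `a`. Stating
    -- membership through `t ^ suc q ≤ b ^ p` spares evaluating any root.
    ≤-rpow : ∀ {a} p q {t} → fromℕ p ≤ a * fromℕ (suc q) → 0# ≤ t → t ^ suc q ≤ b ^ p → t ≤ rpow b a
    ≤-rpow {a} p q {t} p≤aq 0≤t t^q≤b^p = ≤-trans (≤-root q (0≤b^ p) 0≤t t^q≤b^p)
      (sup-upper (RationalPowers b a)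
        (RationalPowers-≤ λ p q t p≤aq 0≤t t^q≤b^p → ^-cancel-≤ q (0≤b^ n)
          (≤-trans t^q≤b^p (≤-cong refl (sym (^-assocʳ b n (suc q)))
            (^-monoʳ-≤ {m = p} {n = n ℕ.* suc q} 1≤b (fromℕ-cancel-≤ (≤-trans p≤aq
              (≤-cong (*-comm _ _) (trans (*-comm _ _) (sym (fromℕ-* n (suc q)))) (*-monoˡ-≤ (0≤fromℕ (suc q)) a≤n))))))))
        (p , q , p≤aq , refl))
      where
      n = proj₁ (archimedean a)
      a≤n = <⇒≤ (proj₂ (archimedean a))

    1≤rpow : ∀ {a} → 0# ≤ a → 1# ≤ rpow b a
    1≤rpow 0≤a = ≤-rpow 0 0 (*-nonNegative 0≤a (0≤fromℕ 1)) 0≤1 (≤-reflexive (*-identityʳ 1#))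

    module _ {a a′ : Carrier} (k : ℕ) (0≤a : 0# ≤ a) (0≤a′ : 0# ≤ a′) (a+a′≈k : a + a′ ≈ fromℕ k) where

      private
        B = b ^ k
        0<B : 0# < B
        0<B = ^-pos k (<-≤-trans 0<1 1≤b)
        0<rpow : 0# < rpow b a
        0<rpow = <-≤-trans 0<1 (1≤rpow 0≤a)
        0<rpow′ : 0# < rpow b a′
        0<rpow′ = <-≤-trans 0<1 (1≤rpow 0≤a′)

      -- Raised to the power `Q * Q′`, the claim becomes p / Q + p′ / Q′ ≤ a + a′ = k with
      -- denominators cleared.
      root-*-root-≤ : ∀ p q t p′ q′ t′ → fromℕ p ≤ a * fromℕ (suc q) → 0# ≤ t → t ^ suc q ≤ b ^ p →
        fromℕ p′ ≤ a′ * fromℕ (suc q′) → 0# ≤ t′ → t′ ^ suc q′ ≤ b ^ p′ → t * t′ ≤ B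
      -- The exponent given to `^-cancel-≤` is the predecessor of `Q * Q′`.
      root-*-root-≤ p q t p′ q′ t′ p≤aq 0≤t t^q≤ p′≤a′q′ 0≤t′ t′^q′≤ = ^-cancel-≤ (q′ ℕ.+ q ℕ.* suc q′) (<⇒≤ 0<B) (≤-cong
        (begin
          (t ^ Q) ^ Q′ * (t′ ^ Q′) ^ Q     ≈⟨ *-cong (^-assocʳ t Q Q′) (^-assocʳ t′ Q′ Q) ⟩
          t ^ (Q ℕ.* Q′) * t′ ^ (Q′ ℕ.* Q) ≈⟨ *-congˡ (^-congʳ t′ (ℕ.*-comm Q′ Q)) ⟩
          t ^ (Q ℕ.* Q′) * t′ ^ (Q ℕ.* Q′) ≈⟨ ^-distrib-* t t′ (Q ℕ.* Q′) ⟨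
          (t * t′) ^ (Q ℕ.* Q′)            ∎)
        (sym (^-assocʳ b k (Q ℕ.* Q′)))
        (≤-trans
          (*-mono-≤ (^-nonNegative Q′ (^-nonNegative Q 0≤t)) (^-mono-≤ Q′ (^-nonNegative Q 0≤t) t^q≤)
                    (^-nonNegative Q (^-nonNegative Q′ 0≤t′)) (^-mono-≤ Q (^-nonNegative Q′ 0≤t′) t′^q′≤))
          (≤-cong
            (trans (^-homo-* b (p ℕ.* Q′) (p′ ℕ.* Q)) (sym (*-cong (^-assocʳ b p Q′) (^-assocʳ b p′ Q))))
            refl
            (^-monoʳ-≤ {m = p ℕ.* Q′ ℕ.+ p′ ℕ.* Q} {n = k ℕ.* (Q ℕ.* Q′)} 1≤b (fromℕ-cancel-≤ exponents)))))
        where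
        Q  = suc q
        Q′ = suc q′
        exponents : fromℕ (p ℕ.* Q′ ℕ.+ p′ ℕ.* Q) ≤ fromℕ (k ℕ.* (Q ℕ.* Q′))
        exponents = ≤-cong
          (trans (+-cong (trans (*-comm _ _) (sym (fromℕ-* p Q′))) (trans (*-comm _ _) (sym (fromℕ-* p′ Q))))
            (sym (fromℕ-+ (p ℕ.* Q′) (p′ ℕ.* Q))))
          (begin
            fromℕ Q′ * (a * fromℕ Q) + fromℕ Q * (a′ * fromℕ Q′)
              ≈⟨ solve 4 (λ a a′ q q′ → q′ :* (a :* q) :+ q :* (a′ :* q′) := (a :+ a′) :* (q :* q′))
                   refl a a′ (fromℕ Q) (fromℕ Q′) ⟩
            (a + a′) * (fromℕ Q * fromℕ Q′)    ≈⟨ *-cong a+a′≈k (sym (fromℕ-* Q Q′)) ⟩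
            fromℕ k * fromℕ (Q ℕ.* Q′)         ≈⟨ fromℕ-* k (Q ℕ.* Q′) ⟨
            fromℕ (k ℕ.* (Q ℕ.* Q′))           ∎)
          (*-monoˡ-≤ (0≤fromℕ Q′) p≤aq ⊕ *-monoˡ-≤ (0≤fromℕ Q) p′≤a′q′)

      -- The two suprema are bounded one after the other, each time by dividing by the other factor.
      rpow-*-≤ : rpow b a * rpow b a′ ≤ B
      rpow-*-≤ = /-≤ 0<rpow′ (rpow-≤ 0≤a λ p q t p≤aq 0≤t t^q≤ → ≤-/ 0<rpow′
        (≤-cong (*-comm _ _) refl (rpow′-*-≤ p q t p≤aq 0≤t t^q≤)))
        where
        rpow′-*-≤ : ∀ p q t → fromℕ p ≤ a * fromℕ (suc q) → 0# ≤ t → t ^ suc q ≤ b ^ p → rpow b a′ * t ≤ B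
        -- Zero is split off because the next step divides by `t`.
        rpow′-*-≤ p q t p≤aq 0≤t t^q≤ with t ≤? 0#
        ... | yes t≤0 = ≤-trans (≤-reflexive (trans (*-congˡ (antisym t≤0 0≤t)) (zeroʳ (rpow b a′)))) (<⇒≤ 0<B)
        ... | no  t≰0 = /-≤ (≰⇒> t≰0) (rpow-≤ 0≤a′ λ p′ q′ t′ p′≤ 0≤t′ t′^q′≤ → ≤-/ (≰⇒> t≰0)
          (≤-cong (*-comm _ _) refl (root-*-root-≤ p q t p′ q′ t′ p≤aq 0≤t t^q≤ p′≤ 0≤t′ t′^q′≤)))

      -- Compare with the rational exponents ⌊ a q ⌋ / q and ⌊ a′ q ⌋ / q: their sum
      -- misses k by less than 2 / q, so B ^ q ≤ b (t t′) ^ q for every q.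
      rpow-<-*-< : ∀ {t t′} → rpow b a < t → rpow b a′ < t′ → B ≤ t * t′
      rpow-<-*-< {t} {t′} a<t a′<t′ with B ≤? t * t′
      ... | yes h = h
      ... | no  h = contradiction bounded (¬^-bounded-ratio (*-pos 0<t 0<t′) (≰⇒> h))
        where
        0<t : 0# < t
        0<t = <-trans 0<rpow a<t
        0<t′ : 0# < t′
        0<t′ = <-trans 0<rpow′ a′<t′
        b^≤ : ∀ {a t} p q → fromℕ p ≤ a * fromℕ (suc q) → 0# ≤ t → rpow b a < t → b ^ p ≤ t ^ suc q
        b^≤ p q p≤aq 0≤t rpow<t = <⇒≤ (≰⇒> λ t^q≤b^p → <⇒≱ rpow<t (≤-rpow p q p≤aq 0≤t t^q≤b^p))
        bounded : ∀ q → B ^ suc q ≤ b * (t * t′) ^ suc q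
        bounded q =
          let Q = suc q
              p  , p≤  , <p+1  = floor-nonNegative (*-nonNegative 0≤a (0≤fromℕ Q))
              p′ , p′≤ , <p′+1 = floor-nonNegative (*-nonNegative 0≤a′ (0≤fromℕ Q))
              -- Between natural numbers, a deficit below 2 is at most 1; hence a single surplus
              -- factor `b`.
              kQ<p+p′+2 : fromℕ (k ℕ.* Q) < fromℕ (suc (suc (p ℕ.+ p′)))
              kQ<p+p′+2 = <-cong
                (trans (sym (distribʳ _ _ _)) (trans (*-congʳ a+a′≈k) (sym (fromℕ-* k Q))))
                (trans (solve 2 (λ p p′ → con (+ 1) :+ p :+ (con (+ 1) :+ p′) := con (+ 1) :+ (con (+ 1) :+ (p :+ p′))) refl (fromℕ p) (fromℕ p′))
                  (+-congˡ (+-congˡ (sym (fromℕ-+ p p′)))))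
                (<p+1 <⊕ <⇒≤ <p′+1)
          in ≤-cong (sym (^-assocʳ b k Q)) (*-congˡ (sym (^-distrib-* t t′ Q)))
            (≤-trans (^-monoʳ-≤ {m = k ℕ.* Q} {n = suc (p ℕ.+ p′)} 1≤b (ℕ.≤-pred (fromℕ-cancel-< kQ<p+p′+2)))
              (*-monoˡ-≤ (≤-trans 0≤1 1≤b) (≤-cong (sym (^-homo-* b p p′)) refl
                (*-mono-≤ (0≤b^ p) (b^≤ p q p≤ (<⇒≤ 0<t) a<t) (0≤b^ p′) (b^≤ p′ q p′≤ (<⇒≤ 0<t′) a′<t′)))))

      -- If the product fell short of `B`, there would be room for `t` and `t′` strictly above the
      -- two real powers with `t * t′ < B`. Strictness makes their powers dominate those of `b`.
      rpow-*-≥ : B ≤ rpow b a * rpow b a′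
      rpow-*-≥ with B ≤? rpow b a * rpow b a′
      ... | yes h = h
      ... | no  h =
        let t  , a<t , t<   = <-dense (<-/ 0<rpow′ (≰⇒> h))
            0<t             = <-trans 0<rpow a<t
            t′ , a′<t′ , t′< = <-dense (<-/ 0<t (<-cong (*-comm _ _) refl (/-< 0<rpow′ t<)))
        in contradiction (≤-cong refl (*-comm _ _) (rpow-<-*-< a<t a′<t′)) (<⇒≱ (/-< 0<t t′<))

      -- The one exponent law required; with `k = 2` it exchanges division by N ^ δ for
      -- multiplication by N ^ (2 - δ).
      rpow-* : rpow b a * rpow b a′ ≈ b ^ k
      rpow-* = antisym rpow-*-≤ rpow-*-≥

  -- Weak γ-PPC

  archimedean-* : ∀ {x} → 0# < x → ∃[ n ] 1# < x * fromℕ n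
  archimedean-* {x} 0<x =
    let n , x⁻¹<n = archimedean (x ⁻¹)
    in n , <-cong (⁻¹-inverseʳ x (≉0 0<x)) refl (*-monoˡ-< 0<x x⁻¹<n)

  1≤*fromℕ : ∀ {x m n} → 0# < x → 1# < x * fromℕ m → m ℕ.≤ n → 1# ≤ x * fromℕ n
  1≤*fromℕ 0<x 1<xm m≤n = ≤-trans (<⇒≤ 1<xm) (*-monoˡ-≤ (<⇒≤ 0<x) (fromℕ-mono-≤ m≤n))

  module _ (γ : Carrier) {δ : Carrier} (0<δ : 0# < δ) (δ<1 : δ < 1#) where

    private
      0<1-δ : 0# < 1# - δ
      0<1-δ = 0<-diff δ<1
      -- Chosen so that 1 / (q + 1) is at most δ and at most 1 - δ; the sum of the two candidates
      -- serves as a common upper bound.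
      q₁ q₂ q : ℕ
      q₁ = proj₁ (archimedean-* 0<δ)
      q₂ = proj₁ (archimedean-* 0<1-δ)
      q  = q₁ ℕ.+ q₂
      1≤δ*q : 1# ≤ δ * fromℕ (suc q)
      1≤δ*q = 1≤*fromℕ {m = q₁} {n = suc q} 0<δ (proj₂ (archimedean-* 0<δ))
        (ℕ.≤-trans (ℕ.m≤m+n q₁ q₂) (ℕ.n≤1+n q))
      1≤[1-δ]*q : 1# ≤ (1# - δ) * fromℕ (suc q)
      1≤[1-δ]*q = 1≤*fromℕ {m = q₂} {n = suc q} 0<1-δ (proj₂ (archimedean-* 0<1-δ))
        (ℕ.≤-trans (ℕ.m≤n+m q₂ q₁) (ℕ.n≤1+n q))
      0≤2-δ : 0# ≤ fromℕ 2 - δ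
      0≤2-δ = ≤-by (<⇒≤ 0<1-δ ⊕ 0≤1)
        (solve 1 (λ d → con (+ 1) :- d :+ con (+ 1) :- (con (+ 0) :+ con (+ 0)) := con (+ 2) :- d :- con (+ 0)) refl δ)

    -- N ^ δ is unbounded, by comparison with the exponent 1 / (q + 1) ≤ δ; this makes the radius
    -- small.
    fromℕ≤rpow-δ : ∀ {l n} → l ℕ.^ suc q ℕ.≤ n → 1 ℕ.≤ n → fromℕ l ≤ rpow (fromℕ n) δ
    fromℕ≤rpow-δ {l} {n} l^q≤n 1≤n = ≤-rpow (1≤fromℕ 1≤n) 1 q
      (≤-cong (sym fromℕ-1) refl 1≤δ*q) (0≤fromℕ l)
      (≤-cong (fromℕ-^ l (suc q)) (sym (*-identityʳ (fromℕ n))) (fromℕ-mono-≤ l^q≤n))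

    -- Comparison with the exponent 1 + 1 / (q + 1) ≤ 2 - δ. With `l` a multiple of log N this shows
    -- that N log N is negligible.
    fromℕ≤rpow-2-δ : ∀ {l n} → l ℕ.^ suc q ℕ.≤ n → 1 ℕ.≤ n → fromℕ l * fromℕ n ≤ rpow (fromℕ n) (fromℕ 2 - δ)
    fromℕ≤rpow-2-δ {l} {n} l^q≤n 1≤n = ≤-rpow (1≤fromℕ 1≤n) (suc (suc q)) q
      (≤-by 1≤[1-δ]*q (solve 2 (λ d q → (con (+ 1) :- d) :* q :- con (+ 1) := (con (+ 2) :- d) :* q :- (con (+ 1) :+ q))
        refl δ (fromℕ (suc q))))
      (*-nonNegative (0≤fromℕ l) (0≤fromℕ n))
      (≤-cong (sym (^-distrib-* (fromℕ l) (fromℕ n) (suc q))) refl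
        (≤-cong (*-comm _ _) (*-comm _ _)
          (*-monoˡ-≤ (^-nonNegative (suc q) (0≤fromℕ n))
            (≤-cong (fromℕ-^ l (suc q)) refl (fromℕ-mono-≤ l^q≤n)))))

    vdcSequence-HasWeakPPC : HasWeakPPC γ δ vdcSequence
    vdcSequence-HasWeakPPC s 0<s ε 0<ε = n₀ , close
      where
      -- `l` exceeds 2 s, so that N ^ δ ≥ `l` yields `r < ½`; `m` exceeds 1 / ε and sets the factor
      -- by which N ^ (2 - δ) must outweigh the error.
      l : ℕ
      l = proj₁ (archimedean (s + s))
      m : ℕ
      m = proj₁ (archimedean-* 0<ε)
      -- The threshold of `[l[1+k]]^q≤n` for the factor `suc m` and the exponent `suc q`;
      -- `n ≥ 2 ^ j₀` puts the binary length of `n` past it.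
      j₀ : ℕ
      j₀ = suc (pred (4 ℕ.* suc m ℕ.^ suc q)) ℕ.* suc (suc q) ℕ.^ suc (suc q)
      n₀ : ℕ
      n₀ = l ℕ.^ suc q ℕ.+ 2 ℕ.^ j₀
      close : ∀ n → n₀ ℕ.≤ n →
        ∣ 1# / rpow (fromℕ n) (fromℕ 2 - δ) * fromℕ (pairCount vdcSequence γ (s / rpow (fromℕ n) δ) n) - fromℕ 2 * s ∣ < ε
      close zero    n₀≤0 with () ← ℕ.≤-trans (ℕ.m^n>0 2 j₀) (ℕ.≤-trans (ℕ.m≤n+m (2 ℕ.^ j₀) (l ℕ.^ suc q)) n₀≤0)
      close n@(suc n′) n₀≤n = ∣x∣< upper lower
        where
        1≤n : 1 ℕ.≤ n
        1≤n = ℕ.s≤s ℕ.z≤n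
        k : ℕ
        k = proj₁ (binaryLength n′)
        n<2^k = proj₁ (proj₂ (binaryLength n′))
        2^k≤2n = proj₂ (proj₂ (binaryLength n′))
        j₀≤1+k : j₀ ℕ.≤ suc k
        j₀≤1+k = ℕ.≤-trans (ℕ.<⇒≤ (2^-cancel-<
          (ℕ.≤-<-trans (ℕ.≤-trans (ℕ.m≤n+m (2 ℕ.^ j₀) (l ℕ.^ suc q)) n₀≤n) n<2^k))) (ℕ.n≤1+n k)
        N a A r u e C : Carrier
        N = fromℕ n
        a = rpow N δ
        A = rpow N (fromℕ 2 - δ)
        r = s / a
        u = A ⁻¹
        e = N * fromℕ (suc k)
        C = fromℕ (pairCount vdcSequence γ r n)
        0<N : 0# < N
        0<N = 0<fromℕ 1≤n
        0<a : 0# < a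
        0<a = <-≤-trans 0<1 (1≤rpow (1≤fromℕ 1≤n) (<⇒≤ 0<δ))
        0<A : 0# < A
        0<A = <-≤-trans 0<1 (1≤rpow (1≤fromℕ 1≤n) 0≤2-δ)
        0<u : 0# < u
        0<u = ⁻¹-pos 0<A
        0≤r : 0# ≤ r
        0≤r = <⇒≤ (*-pos 0<s (⁻¹-pos 0<a))
        2s<a : s + s < a
        2s<a = <-≤-trans (proj₂ (archimedean (s + s)))
          (fromℕ≤rpow-δ {l} (ℕ.≤-trans (ℕ.m≤m+n (l ℕ.^ suc q) (2 ℕ.^ j₀)) n₀≤n) 1≤n)
        r<½ : r < ½
        r<½ = <-cong (*-comm _ _) (*-/-cancel ½ 0<a) (*-monoˡ-< (⁻¹-pos 0<a)
          (<-cong (trans (distribˡ ½ s s) (½*-double s)) refl (*-monoˡ-< 0<½ 2s<a)))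
        me≤A : fromℕ (suc m) * e ≤ A
        me≤A = ≤-cong
          (trans (*-congʳ (fromℕ-* (suc m) (suc k)))
            (solve 3 (λ m k n → m :* k :* n := m :* (n :* k)) refl (fromℕ (suc m)) (fromℕ (suc k)) N)) refl
          (fromℕ≤rpow-2-δ {suc m ℕ.* suc k} ([l[1+k]]^q≤n m (suc q) j₀≤1+k 2^k≤2n) 1≤n)
        e<Aε : e < A * ε
        e<Aε = <-≤-trans
          (<-cong (*-identityʳ e) refl (*-monoˡ-< 0<e (<-≤-trans (proj₂ (archimedean-* 0<ε))
            (*-monoˡ-≤ (<⇒≤ 0<ε) (fromℕ-mono-≤ (ℕ.n≤1+n m))))))
          (≤-cong (solve 3 (λ x m e → x :* (m :* e) := e :* (x :* m)) refl ε (fromℕ (suc m)) e) (*-comm _ _)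
            (*-monoˡ-≤ (<⇒≤ 0<ε) me≤A))
          where
          0<e : 0# < e
          0<e = *-pos 0<N (0<fromℕ {suc k} (ℕ.s≤s ℕ.z≤n))
        main-term : N * (N * (r + r)) ≈ A * (s + s)
        main-term = begin
          N * (N * (s * a ⁻¹ + s * a ⁻¹))
            -- `N * (N * 1#)` is what `N ^ 2` unfolds to, the form in which `rpow-*` supplies it.
            ≈⟨ solve 3 (λ n s i → n :* (n :* (s :* i :+ s :* i)) := n :* (n :* con (+ 1)) :* (s :+ s) :* i) refl N s (a ⁻¹) ⟩
          N * (N * 1#) * (s + s) * a ⁻¹
            ≈⟨ *-congʳ (*-congʳ (rpow-* (1≤fromℕ 1≤n) 2 0≤2-δ (<⇒≤ 0<δ)
                 (solve 1 (λ d → con (+ 2) :- d :+ d := con (+ 2)) refl δ))) ⟨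
          A * a * (s + s) * a ⁻¹
            ≈⟨ solve 4 (λ A a s i → A :* a :* (s :+ s) :* i := i :* (A :* (s :+ s) :* a)) refl A a s (a ⁻¹) ⟩
          a ⁻¹ * (A * (s + s) * a)
            ≈⟨ *-/-cancel (A * (s + s)) 0<a ⟩
          A * (s + s) ∎
        count-bounds = pairCount-bounds γ 0≤r r<½ k n n<2^k
        C<  : C < (s + s + ε) * A
        C< = <-by (proj₂ count-bounds ⊕< e<Aε <⊕ ≤-reflexive main-term)
          (solve 6 (λ A s x C M e → M :+ e :+ (A :* x :+ A :* (s :+ s)) :- (C :+ (e :+ M)) := (s :+ s :+ x) :* A :- C)
            refl A s ε C (N * (N * (r + r))) e)
        <C : (s + s - ε) * A < C
        <C = <-by (proj₁ count-bounds ⊕< e<Aε <⊕ ≤-reflexive (sym main-term))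
          (solve 6 (λ A s x C M e → C :+ (A :* x :+ M) :- (M :- e :+ (e :+ A :* (s :+ s))) := C :- (s :+ s :- x) :* A)
            refl A s ε C (N * (N * (r + r))) e)
        upper : 1# / A * C - fromℕ 2 * s < ε
        upper = <-by (<-cong refl (*-/-cancel (s + s + ε) 0<A) (*-monoˡ-< 0<u C<))
          (solve 4 (λ s x C u → s :+ s :+ x :- u :* C := x :- (con (+ 1) :* u :* C :- con (+ 2) :* s)) refl s ε C u)
        lower : - (1# / A * C - fromℕ 2 * s) < ε
        lower = <-by (<-cong (*-/-cancel (s + s - ε) 0<A) refl (*-monoˡ-< 0<u <C))
          (solve 4 (λ s x C u → u :* C :- (s :+ s :- x) := x :- (:- (con (+ 1) :* u :* C :- con (+ 2) :* s))) refl s ε C u)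

theorem1p1 : (R : CompleteOrderedField) → let open RealNotions R in
    ∀ (γ δ : Carrier) → 0# < γ → γ ≤ 1# / fromℕ 2 → 0# < δ → δ < 1# →
    ∃[ x ] InUnitInterval x × HasWeakPPC γ δ x × ¬ HasPPC γ x
theorem1p1 R γ δ _ _ 0<δ δ<1 =
  vdcSequence R , vdcSequence-InUnitInterval R , vdcSequence-HasWeakPPC R γ 0<δ δ<1 , ¬vdcSequence-HasPPC R γ
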